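{- Let $p$ be a prime, let $|\cdot|_\infty$ be the usual absolute value and $|\cdot|_p$ the $p$-adic absolute value on $\mathbb{Q}$, let $b\in\mathbb{Q}\cap(\mathbb{Z}_p\setminus\mathbb{Z})$, and consider the power series $$\sum_{n=0}^{\infty}\frac{b(b-1)\cdots(b-n+1)}{n!}x^n .$$ (i) The radius of convergence of this power series is equal to $1$ with respect to the usual absolute value, and it is also equal to $1$ with respect to the $p$-adic absolute value. (ii) The set of rational numbers $x$ at which the power series converges both with respect to the usual absolute value and with respect to the $p$-adic absolute value within the common radius of convergence $1$, i.e. the set of $x\in\mathbb{Q}$ belonging to both $\{x\in\mathbb{Q}:|x|_\infty<1\}$ and $\{x\in\mathbb{Q}:|x|_p<1\}$ (at which the power series converges in $\mathbb{R}$ and in $\mathbb{Q}_p$), is $$\Big\{x\in\mathbb{Q}: x=\tfrac{u}{v},\ u,v\in\mathbb{Z},\ (u,v)=1,\ |u|_\infty\le|v|_\infty,\ p\mid u,\ p\nmid v\Big\}.$$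
   Context: $\mathbb{Q}_p$ is the field of $p$-adic numbers and $\mathbb{Z}_p$ the ring of $p$-adic integers; $|\cdot|_p$ is normalized by $|p^k\frac{a}{d}|_p=p^{ -k}$ for integers $a,d$ not divisible by $p$, and $|0|_p=0$. The $n=0$ coefficient of the series is $1$. The radius of convergence $R$ of $\sum a_nx^n$ with respect to an absolute value $|\cdot|$ is given by $1/R=\limsup_{n\to\infty}|a_n|^{1/n}$. $(u,v)$ denotes the greatest common divisor. -}

module Defs where

open import Level using (0ℓ)
open import Data.Nat as ℕ using (ℕ; zero; suc; _!)
open import Data.Nat.Properties using (m^n≢0; _!≢0)
import Data.Nat.Divisibility as ℕ
open import Data.Nat.Primality using (Prime; prime⇒nonZero)
open import Data.Integer as ℤ using (ℤ; +_; +[1+_]; -[1+_]; 1ℤ)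
open import Data.Integer.Divisibility using (_∣_)
open import Data.Integer.GCD using (gcd)
open import Data.Rational
  using (ℚ; ↥_; ↧ₙ_; _/_; _+_; _*_; _-_; _<_; _≤_; 0ℚ; 1ℚ; 1/_; Positive; +-*-rawSemiring)
open import Data.Rational.Properties using (pos⇒nonZero)
open import Algebra.Definitions.RawSemiring +-*-rawSemiring using (_^_)
open import Data.Product using (Σ; ∃; ∃-syntax; _×_; _,_)
open import Data.Sum using (_⊎_)
open import Function using (_⇔_)
open import Relation.Binary.PropositionalEquality using (_≡_)
open import Relation.Nullary using (¬_; yes; no)
open import Relation.Unary using (Pred)

-- The largest k ≤ m with p ^ k ∣ n (or 0 if there is none).
maxExponent≤ : (m p n : ℕ) → ℕ
maxExponent≤ zero    p n = 0
maxExponent≤ (suc k) p n with (p ℕ.^ suc k) ℕ.∣? n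
... | yes _ = suc k
... | no  _ = maxExponent≤ k p n

-- For p ≥ 2 and n ≥ 1, p ^ k ∣ n forces k ≤ n, so the bound n loses nothing.
multiplicity : (p n : ℕ) → ℕ
multiplicity p n = maxExponent≤ n p n

-- For n / d in lowest terms, |n / d|ₚ = p ^ (multiplicity of p in d) / p ^ (multiplicity of p in n).
padicAbs : {p : ℕ} → Prime p → ℚ → ℚ
padicAbs {p} p-prime x = ratio ℤ.∣ ↥ x ∣ (↧ₙ x)
  where
  instance _ = prime⇒nonZero p-prime
  ratio : ℕ → ℕ → ℚ
  ratio zero      d = 0ℚ
  ratio n@(suc _) d = _/_ (+ (p ℕ.^ multiplicity p d)) (p ℕ.^ multiplicity p n) {{m^n≢0 p (multiplicity p n)}}

IsInteger : Pred ℚ 0ℓ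
IsInteger x = ∃[ k ] x ≡ k / 1

-- The rational numbers lying in ℤₚ = { x ∈ ℚₚ : |x|ₚ ≤ 1 }.
IsPadicInteger : {p : ℕ} → Prime p → Pred ℚ 0ℓ
IsPadicInteger p-prime x = padicAbs p-prime x ≤ 1ℚ

fallingFactorial : ℚ → ℕ → ℚ
fallingFactorial b zero    = 1ℚ
fallingFactorial b (suc n) = fallingFactorial b n * (b - + n / 1)

binomialCoeff : ℚ → ℕ → ℚ
binomialCoeff b n = fallingFactorial b n * _/_ 1ℤ (n !) {{n !≢0}}

-- Extended real numbers, given by the rationals strictly below and strictly
-- above them.  No locatedness is required, so arbitrary suprema and infima
-- exist; an empty Above (Below) stands for +∞ (-∞).
record Cut : Set₁ where
  field
    Below : Pred ℚ 0ℓ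
    Above : Pred ℚ 0ℓ

open Cut public

infix 4 _≐ᶜ_
_≐ᶜ_ : Cut → Cut → Set
s ≐ᶜ t = ∀ c → (Below s c ⇔ Below t c) × (Above s c ⇔ Above t c)

fromℚ : ℚ → Cut
fromℚ q = record { Below = λ c → c < q ; Above = λ c → q < c }

-- The real number a ^ (1/n), for a ≥ 0 and n ≥ 1.
root : ℕ → ℚ → Cut
root n a = record
  { Below = λ c → c < 0ℚ ⊎ c ^ n < a
  ; Above = λ c → 0ℚ < c × a < c ^ n
  }

-- All members may lie strictly above (below) c without their infimum
-- (supremum) doing so, hence the intermediate rational c′.
sup inf : {I : Set} → (I → Cut) → Cut
sup s = record
  { Below = λ c → ∃[ i ] Below (s i) c
  ; Above = λ c → ∃[ c′ ] (c′ < c × (∀ i → Above (s i) c′))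
  }
inf s = record
  { Below = λ c → ∃[ c′ ] (c < c′ × (∀ i → Below (s i) c′))
  ; Above = λ c → ∃[ i ] Above (s i) c
  }

-- The tails are { n : N < n }, so s 0 never matters.
limsup : (ℕ → Cut) → Cut
limsup s = inf λ N → sup {I = ∃[ n ] N ℕ.< n} λ (n , _) → s n

HasRadiusOfConvergence : (∣_∣ : ℚ → ℚ) (a : ℕ → ℚ) (R : ℚ) → .{{Positive R}} → Set
HasRadiusOfConvergence ∣_∣ a R =
  limsup (λ n → root n ∣ a n ∣) ≐ᶜ fromℚ ((1/ R) {{pos⇒nonZero R}})

IsCauchy : (∣_∣ : ℚ → ℚ) → (ℕ → ℚ) → Set
IsCauchy ∣_∣ s = ∀ ε → 0ℚ < ε → ∃[ N ] (∀ m n → N ℕ.≤ m → N ℕ.≤ n → ∣ s m - s n ∣ < ε)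

-- The completion of ℚ for an absolute value (ℝ for the usual one, ℚₚ for the
-- p-adic one), each point being represented by a Cauchy sequence.
record Completion (∣_∣ : ℚ → ℚ) : Set where
  field
    seq    : ℕ → ℚ
    cauchy : IsCauchy ∣_∣ seq

open Completion public

-- The distance from q to y, that is lim ∣ q - seq y m ∣, is less than ε.
DistanceLessThan : (∣_∣ : ℚ → ℚ) → ℚ → Completion ∣_∣ → ℚ → Set
DistanceLessThan ∣_∣ q y ε =
  ∃[ δ ] (δ < ε × ∃[ M ] (∀ m → M ℕ.≤ m → ∣ q - seq y m ∣ ≤ δ))

ConvergesTo : (∣_∣ : ℚ → ℚ) → (ℕ → ℚ) → Completion ∣_∣ → Set
ConvergesTo ∣_∣ s y =
  ∀ ε → 0ℚ < ε → ∃[ N ] (∀ n → N ℕ.≤ n → DistanceLessThan ∣_∣ (s n) y ε)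

partialSum : (ℕ → ℚ) → ℚ → ℕ → ℚ
partialSum a x zero    = 0ℚ
partialSum a x (suc n) = partialSum a x n + a n * x ^ n

-- The rational points x at which Σ aₙ xⁿ converges in the completion of ℚ.
ConvergenceSet : (∣_∣ : ℚ → ℚ) → (ℕ → ℚ) → Pred ℚ 0ℓ
ConvergenceSet ∣_∣ a x = ∃[ y ] ConvergesTo ∣_∣ (partialSum a x) y

OpenDisc : (∣_∣ : ℚ → ℚ) → ℚ → Pred ℚ 0ℓ
OpenDisc ∣_∣ R x = ∣ x ∣ < R

-- The library's _/_ only takes natural denominators.
infixl 7 _/ᶻ_
_/ᶻ_ : (u v : ℤ) → .{{ℤ.NonZero v}} → ℚ
u /ᶻ +[1+ n ] = u / suc n
u /ᶻ -[1+ n ] = (ℤ.- u) / suc n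

ReducedFractions : ℕ → Pred ℚ 0ℓ
ReducedFractions p x =
  ∃[ u ] ∃[ v ] Σ (ℤ.NonZero v) λ v≢0 →
    x ≡ (u /ᶻ v) {{v≢0}}
    × gcd u v ≡ 1ℤ
    × ℤ.∣ u ∣ ℕ.≤ ℤ.∣ v ∣
    × + p ∣ u
    × ¬ (+ p ∣ v)

{-# OPTIONS --safe #-}

-- For both absolute values the radius is read off from two properties of the
-- coefficients aₙ: for every c > 1 eventually |aₙ| < cⁿ, and for every
-- 0 < c < 1 infinitely often cⁿ < |aₙ|.  For the usual absolute value both
-- follow from |aₙ₊₁| / |aₙ| = |b - n| / (n + 1) → 1.  For the p-adic one, write
-- b ≡ m mod pᵏ with 0 ≤ m < pᵏ: comparing b(b-1)⋯(b-n+1) with m(m-1)⋯(m-n+1),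
-- a multiple of n!, for large k gives |aₙ|ₚ ≤ 1, while |aₘ|ₚ = 1 because
-- aₘ = ∏ (j + (b - m)) / j over 1 ≤ j ≤ m, where |b - m|ₚ < |j|ₚ; since b is
-- not an integer these m are unbounded.
module Submission where

open import Defs
open import Algebra.Bundles using (CommutativeRing)
open import Data.Integer as ℤ using (ℤ; 0ℤ; 1ℤ)
import Data.Integer.DivMod as ℤ
import Data.Integer.Divisibility.Signed as Signed
import Data.Integer.Properties as ℤ
open import Data.Integer.Tactic.RingSolver using () renaming (solve-∀ to ℤ-solve-∀)
open import Data.Nat as ℕ using (ℕ; zero; suc; _!)
import Data.Nat.Coprimality as ℕ
import Data.Nat.Divisibility as ℕ
import Data.Nat.GCD as ℕ
open import Data.Nat.Primality using (Prime; prime⇒nonZero; prime⇒nonTrivial; prime⇒irreducible; euclidsLemma)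
import Data.Nat.Properties as ℕ
open import Data.Product using (∃-syntax; _×_; _,_; proj₁; proj₂)
open import Data.Rational
open import Data.Rational.Properties
import Data.Rational.Unnormalised as ℚᵘ
import Data.Rational.Unnormalised.Properties as ℚᵘ
open import Data.Sum using (_⊎_; inj₁; inj₂; [_,_]′)
open import Function using (mk⇔)
open import Level using (0ℓ)
open import Relation.Binary.PropositionalEquality
open import Relation.Nullary using (¬_; yes; no; contradiction)
open import Relation.Nullary.Decidable using (dec⇒maybe)
open import Relation.Unary using (_∩_; _⊆_; _≐_)
open import Tactic.RingSolver using (solve-∀)
open import Tactic.RingSolver.Core.AlmostCommutativeRing using (AlmostCommutativeRing; fromCommutativeRing)
open import Algebra.Definitions.RawSemiring +-*-rawSemiring using (_^_)
open import Algebra.Properties.CommutativeSemiring.Exp (CommutativeRing.commutativeSemiring +-*-commutativeRing) using (^-distrib-*)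

-- No n-th root is ever extracted: the root cut turns |aₙ|^(1/n) < c into |aₙ| < cⁿ, so both radii
-- reduce to comparing rational powers, and the growth rates involved go back to Bernoulli's
-- inequality. The passage from growth to radius and the convergence of the series are each proved
-- once, for an abstract `f`, and applied to both absolute values. The upper growth bound alone
-- already gives convergence in the open disc; the lower one keeps the radius from exceeding 1. For
-- the usual absolute value the non-integrality of b keeps every coefficient nonzero, without which
-- the ratio test from below could not start.

ℚ-ring : AlmostCommutativeRing 0ℓ 0ℓ
ℚ-ring = fromCommutativeRing +-*-commutativeRing λ x → dec⇒maybe (0ℚ ≟ x)

-- Integers and natural numbers inside the rationals.

z/1≡mkℚ : ∀ z → z / 1 ≡ mkℚ z 0 (ℕ.sym (ℕ.1-coprimeTo ℤ.∣ z ∣))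
z/1≡mkℚ z = ↥p/↧p≡p (mkℚ z 0 (ℕ.sym (ℕ.1-coprimeTo ℤ.∣ z ∣)))

/1-homo-* : ∀ z w → (z ℤ.* w) / 1 ≡ z / 1 * (w / 1)
/1-homo-* z w = sym (cong₂ _*_ (z/1≡mkℚ z) (z/1≡mkℚ w))

/1-homo-+ : ∀ z w → (z ℤ.+ w) / 1 ≡ z / 1 + w / 1
/1-homo-+ z w = sym (trans (cong₂ _+_ (z/1≡mkℚ z) (z/1≡mkℚ w))
  (cong (_/ 1) (cong₂ ℤ._+_ (ℤ.*-identityʳ z) (ℤ.*-identityʳ w))))

/1-homo-neg : ∀ z → (ℤ.- z) / 1 ≡ - (z / 1)
/1-homo-neg (ℤ.+ zero)    = refl
/1-homo-neg (ℤ.+ suc n)   = refl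
/1-homo-neg ℤ.-[1+ n ] = sym (neg-involutive (ℤ.+ suc n / 1))
  where
  neg-involutive : ∀ x → - (- x) ≡ x
  neg-involutive = solve-∀ ℚ-ring

/1-mono-≤ : ∀ {z w} → z ℤ.≤ w → z / 1 ≤ w / 1
/1-mono-≤ {z} {w} z≤w = subst₂ _≤_ (sym (z/1≡mkℚ z)) (sym (z/1≡mkℚ w))
  (*≤* (ℤ.*-monoʳ-≤-nonNeg (ℤ.+ 1) z≤w))

/1-cancel-≤ : ∀ {z w} → z / 1 ≤ w / 1 → z ℤ.≤ w
/1-cancel-≤ {z} {w} le with subst₂ _≤_ (z/1≡mkℚ z) (z/1≡mkℚ w) le
... | *≤* h = ℤ.*-cancelʳ-≤-pos z w (ℤ.+ 1) h

/1-injective : ∀ {z w} → z / 1 ≡ w / 1 → z ≡ w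
/1-injective eq = ℤ.≤-antisym (/1-cancel-≤ (≤-reflexive eq)) (/1-cancel-≤ (≤-reflexive (sym eq)))

fromℕ : ℕ → ℚ
fromℕ n = ℤ.+ n / 1

fromℕ-homo-* : ∀ m n → fromℕ (m ℕ.* n) ≡ fromℕ m * fromℕ n
fromℕ-homo-* m n = trans (cong (_/ 1) (ℤ.pos-* m n)) (/1-homo-* (ℤ.+ m) (ℤ.+ n))

fromℕ-suc : ∀ n → fromℕ (suc n) ≡ 1ℚ + fromℕ n
fromℕ-suc n = /1-homo-+ 1ℤ (ℤ.+ n)

fromℕ-mono-≤ : ∀ {m n} → m ℕ.≤ n → fromℕ m ≤ fromℕ n
fromℕ-mono-≤ m≤n = /1-mono-≤ (ℤ.+≤+ m≤n)

fromℕ-cancel-≤ : ∀ {m n} → fromℕ m ≤ fromℕ n → m ℕ.≤ n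
fromℕ-cancel-≤ le = ℤ.drop‿+≤+ (/1-cancel-≤ le)

0≤fromℕ : ∀ n → 0ℚ ≤ fromℕ n
0≤fromℕ n = fromℕ-mono-≤ {0} {n} ℕ.z≤n

0<1 : 0ℚ < 1ℚ
0<1 = *<* (ℤ.+<+ (ℕ.s≤s ℕ.z≤n))

p<1+p : ∀ p → p < 1ℚ + p
p<1+p p = subst (_< 1ℚ + p) (+-identityˡ p) (+-monoˡ-< p 0<1)

0<fromℕ : ∀ n .{{_ : ℕ.NonZero n}} → 0ℚ < fromℕ n
0<fromℕ n@(suc _) = <-≤-trans 0<1 (fromℕ-mono-≤ {1} {n} (ℕ.s≤s ℕ.z≤n))

[i/n]*n≡i : ∀ i n .{{_ : ℕ.NonZero n}} → i / n * fromℕ n ≡ i / 1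
[i/n]*n≡i i n@(suc k) = toℚᵘ-injective (begin
  toℚᵘ (i / n * fromℕ n)                  ≈⟨ toℚᵘ-homo-* (i / n) (fromℕ n) ⟩
  toℚᵘ (i / n) ℚᵘ.* toℚᵘ (fromℕ n)        ≈⟨ ℚᵘ.*-cong (toℚᵘ-fromℚᵘ (ℚᵘ.mkℚᵘ i k)) (toℚᵘ-fromℚᵘ (ℚᵘ.mkℚᵘ (ℤ.+ n) 0)) ⟩
  ℚᵘ.mkℚᵘ i k ℚᵘ.* ℚᵘ.mkℚᵘ (ℤ.+ n) 0        ≈⟨ ℚᵘ.*≡* (trans (ℤ.*-identityʳ (i ℤ.* ℤ.+ n)) (cong (i ℤ.*_) (sym (ℤ.*-identityʳ (ℤ.+ n))))) ⟩
  ℚᵘ.mkℚᵘ i 0                             ≈⟨ ℚᵘ.≃-sym (toℚᵘ-fromℚᵘ (ℚᵘ.mkℚᵘ i 0)) ⟩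
  toℚᵘ (i / 1)                            ∎)
  where open ℚᵘ.≃-Reasoning

x*↧x≡↥x : ∀ x → x * fromℕ (↧ₙ x) ≡ (↥ x) / 1
x*↧x≡↥x x = trans (cong (_* fromℕ (↧ₙ x)) (sym (↥p/↧p≡p x))) ([i/n]*n≡i (↥ x) (↧ₙ x))

-- Order, products and powers.

*-monoˡ-≤ : ∀ {r p q} → 0ℚ ≤ r → p ≤ q → r * p ≤ r * q
*-monoˡ-≤ {r} 0≤r = *-monoˡ-≤-nonNeg r {{nonNegative 0≤r}}

*-monoʳ-≤ : ∀ {r p q} → 0ℚ ≤ r → p ≤ q → p * r ≤ q * r
*-monoʳ-≤ {r} 0≤r = *-monoʳ-≤-nonNeg r {{nonNegative 0≤r}}

*-monoˡ-< : ∀ {r p q} → 0ℚ < r → p < q → r * p < r * q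
*-monoˡ-< {r} 0<r = *-monoʳ-<-pos r {{positive 0<r}}

*-monoʳ-< : ∀ {r p q} → 0ℚ < r → p < q → p * r < q * r
*-monoʳ-< {r} 0<r = *-monoˡ-<-pos r {{positive 0<r}}

*-mono-≤ : ∀ {p q r s} → 0ℚ ≤ p → 0ℚ ≤ s → p ≤ q → r ≤ s → p * r ≤ q * s
*-mono-≤ 0≤p 0≤s p≤q r≤s = ≤-trans (*-monoˡ-≤ 0≤p r≤s) (*-monoʳ-≤ 0≤s p≤q)

*-cancelˡ-≤ : ∀ {r p q} → 0ℚ < r → r * p ≤ r * q → p ≤ q
*-cancelˡ-≤ {r} 0<r = *-cancelˡ-≤-pos r {{positive 0<r}}

*-cancelʳ-≤ : ∀ {r p q} → 0ℚ < r → p * r ≤ q * r → p ≤ q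
*-cancelʳ-≤ {r} 0<r = *-cancelʳ-≤-pos r {{positive 0<r}}

*-cancelˡ-< : ∀ {r p q} → 0ℚ < r → r * p < r * q → p < q
*-cancelˡ-< {r} 0<r = *-cancelˡ-<-nonNeg r {{pos⇒nonNeg r {{positive 0<r}}}}

*-cancelʳ-≡ : ∀ {r p q} → 0ℚ < r → p * r ≡ q * r → p ≡ q
*-cancelʳ-≡ 0<r eq = ≤-antisym (*-cancelʳ-≤ 0<r (≤-reflexive eq)) (*-cancelʳ-≤ 0<r (≤-reflexive (sym eq)))

0≤* : ∀ {p q} → 0ℚ ≤ p → 0ℚ ≤ q → 0ℚ ≤ p * q
0≤* {p} {q} 0≤p 0≤q = subst (_≤ p * q) (*-zeroʳ p) (*-monoˡ-≤ 0≤p 0≤q)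

0<* : ∀ {p q} → 0ℚ < p → 0ℚ < q → 0ℚ < p * q
0<* {p} {q} 0<p 0<q = subst (_< p * q) (*-zeroʳ p) (*-monoˡ-< 0<p 0<q)

0≤⇒p≤p+q : ∀ {p q} → 0ℚ ≤ q → p ≤ p + q
0≤⇒p≤p+q {p} {q} 0≤q = subst (_≤ p + q) (+-identityʳ p) (+-monoʳ-≤ p 0≤q)

p<q⇒0<q-p : ∀ {p q} → p < q → 0ℚ < q - p
p<q⇒0<q-p {p} {q} p<q = subst (_< q - p) (+-inverseʳ p) (+-monoˡ-< (- p) p<q)

p+[q-p]≡q : ∀ p q → p + (q - p) ≡ q
p+[q-p]≡q = solve-∀ ℚ-ring

0≤^ : ∀ {p} → 0ℚ ≤ p → ∀ n → 0ℚ ≤ p ^ n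
0≤^ 0≤p zero    = <⇒≤ 0<1
0≤^ 0≤p (suc n) = 0≤* 0≤p (0≤^ 0≤p n)

0<^ : ∀ {p} → 0ℚ < p → ∀ n → 0ℚ < p ^ n
0<^ 0<p zero    = 0<1
0<^ 0<p (suc n) = 0<* 0<p (0<^ 0<p n)

^-monoˡ-≤ : ∀ {p q} → 0ℚ ≤ p → p ≤ q → ∀ n → p ^ n ≤ q ^ n
^-monoˡ-≤ 0≤p p≤q zero    = ≤-refl
^-monoˡ-≤ 0≤p p≤q (suc n) = *-mono-≤ 0≤p (0≤^ (≤-trans 0≤p p≤q) n) p≤q (^-monoˡ-≤ 0≤p p≤q n)

1^n≡1 : ∀ n → 1ℚ ^ n ≡ 1ℚ
1^n≡1 zero    = refl
1^n≡1 (suc n) = trans (*-identityˡ (1ℚ ^ n)) (1^n≡1 n)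

^<1 : ∀ {p n} → 0ℚ ≤ p → p < 1ℚ → 0 ℕ.< n → p ^ n < 1ℚ
^<1 {p} {suc n} 0≤p p<1 _ = ≤-<-trans (*-monoˡ-≤ 0≤p (subst (p ^ n ≤_) (1^n≡1 n) (^-monoˡ-≤ 0≤p (<⇒≤ p<1) n)))
  (subst (_< 1ℚ) (sym (*-identityʳ p)) p<1)

1<^ : ∀ {p n} → 1ℚ < p → 0 ℕ.< n → 1ℚ < p ^ n
1<^ {p} {suc n} 1<p _ = <-≤-trans (subst (1ℚ <_) (sym (*-identityʳ p)) 1<p)
  (*-monoˡ-≤ (<⇒≤ (<-trans 0<1 1<p)) (subst (_≤ p ^ n) (1^n≡1 n) (^-monoˡ-≤ (<⇒≤ 0<1) (<⇒≤ 1<p) n)))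

-- The Archimedean property and geometric growth.

∃fromℕ> : ∀ p → ∃[ N ] p < fromℕ N
∃fromℕ> p@(mkℚ z d _) = suc ℤ.∣ z ∣ ,
  ≤-<-trans (subst (p ≤_) (sym (z/1≡mkℚ (ℤ.+ ℤ.∣ z ∣))) (*≤* (z*1≤ z)))
    (subst (fromℕ ℤ.∣ z ∣ <_) (sym (fromℕ-suc ℤ.∣ z ∣)) (p<1+p (fromℕ ℤ.∣ z ∣)))
  where
  z*1≤ : ∀ z → z ℤ.* ℤ.+ 1 ℤ.≤ ℤ.+ ℤ.∣ z ∣ ℤ.* ℤ.+ suc d
  z*1≤ (ℤ.+ n)       = ℤ.*-monoˡ-≤-nonNeg (ℤ.+ n) (ℤ.+≤+ (ℕ.s≤s ℕ.z≤n))
  z*1≤ ℤ.-[1+ n ] = ℤ.-≤+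

archimedean : ∀ p {q} → 0ℚ < q → ∃[ N ] ∀ n → N ℕ.≤ n → p < fromℕ n * q
archimedean p {q} 0<q = let N , p/q<N = ∃fromℕ> (p * 1/ q) in N , λ n N≤n →
  subst (_< fromℕ n * q) p/q*q≡p (*-monoʳ-< 0<q (<-≤-trans p/q<N (fromℕ-mono-≤ N≤n)))
  where
  instance _ = >-nonZero 0<q
  p/q*q≡p : p * 1/ q * q ≡ p
  p/q*q≡p = trans (*-assoc p (1/ q) q) (trans (cong (p *_) (*-inverseˡ q)) (*-identityʳ p))

-- The division-free form of Bernoulli's inequality 1 + n h / α ≤ ((α + h) / α) ^ n.
bernoulli : ∀ {α h} → 0ℚ ≤ α → 0ℚ ≤ h → ∀ n → α ^ n * (α + fromℕ n * h) ≤ α * (α + h) ^ n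
bernoulli {α} {h} 0≤α 0≤h zero = ≤-reflexive (lemma α h)
  where
  lemma : ∀ α h → 1ℚ * (α + 0ℚ * h) ≡ α * 1ℚ
  lemma = solve-∀ ℚ-ring
bernoulli {α} {h} 0≤α 0≤h (suc n) = begin
  α * A * (α + fromℕ (suc n) * h)                ≡⟨ cong (λ m → α * A * (α + m * h)) (fromℕ-suc n) ⟩
  -- The added summand is the quadratic term in `h` that Bernoulli's inequality discards.
  α * A * (α + (1ℚ + fromℕ n) * h)               ≤⟨ 0≤⇒p≤p+q (0≤* (0≤* (0≤^ 0≤α n) (0≤fromℕ n)) (0≤* 0≤h 0≤h)) ⟩
  α * A * (α + (1ℚ + fromℕ n) * h) + A * fromℕ n * (h * h)
                                                 ≡⟨ lemma₁ α h A (fromℕ n) ⟩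
  (α + h) * (A * (α + fromℕ n * h))              ≤⟨ *-monoˡ-≤ (+-mono-≤ 0≤α 0≤h) (bernoulli 0≤α 0≤h n) ⟩
  (α + h) * (α * (α + h) ^ n)                    ≡⟨ lemma₂ (α + h) α ((α + h) ^ n) ⟩
  α * ((α + h) * (α + h) ^ n)                    ∎
  where
  open ≤-Reasoning
  A : ℚ
  A = α ^ n
  lemma₁ : ∀ α h A m → α * A * (α + (1ℚ + m) * h) + A * m * (h * h) ≡ (α + h) * (A * (α + m * h))
  lemma₁ = solve-∀ ℚ-ring
  lemma₂ : ∀ x y z → x * (y * z) ≡ y * (x * z)
  lemma₂ = solve-∀ ℚ-ring

-- By Bernoulli with `h = β - α`, the quotient of `β ^ n` by `α ^ n` is at least 1 + n h / α, and
-- this linear growth eventually exceeds u / v. All inequalities are multiplied out by `α`, and `u`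
-- may have any sign.
geometric-dominates : ∀ {α β u v} → 0ℚ < α → α < β → 0ℚ < v →
  ∃[ N ] ∀ n → N ℕ.≤ n → u * α ^ n < v * β ^ n
geometric-dominates {α} {β} {u} {v} 0<α α<β 0<v = let N , bound = archimedean (u * α) (0<* 0<v 0<h) in
  N , λ n N≤n → *-cancelˡ-< 0<α (begin-strict
    α * (u * α ^ n)                          ≡⟨ lemma₁ α u (α ^ n) ⟩
    u * α * α ^ n                            <⟨ *-monoʳ-< (0<^ 0<α n) (bound n N≤n) ⟩
    fromℕ n * (v * h) * α ^ n                ≤⟨ 0≤⇒p≤p+q (<⇒≤ (0<* (0<* 0<v 0<α) (0<^ 0<α n))) ⟩
    fromℕ n * (v * h) * α ^ n + v * α * α ^ n ≡⟨ lemma₂ (fromℕ n) v h (α ^ n) α ⟩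
    v * (α ^ n * (α + fromℕ n * h))          ≤⟨ *-monoˡ-≤ (<⇒≤ 0<v) (bernoulli (<⇒≤ 0<α) (<⇒≤ 0<h) n) ⟩
    v * (α * (α + h) ^ n)                    ≡⟨ lemma₃ v α ((α + h) ^ n) ⟩
    α * (v * (α + h) ^ n)                    ≡⟨ cong (λ x → α * (v * x ^ n)) (p+[q-p]≡q α β) ⟩
    α * (v * β ^ n)                          ∎)
  where
  open ≤-Reasoning
  h : ℚ
  h = β - α
  0<h : 0ℚ < h
  0<h = p<q⇒0<q-p α<β
  lemma₁ : ∀ x y z → x * (y * z) ≡ y * x * z
  lemma₁ = solve-∀ ℚ-ring
  lemma₂ : ∀ m v h A α → m * (v * h) * A + v * α * A ≡ v * (A * (α + m * h))
  lemma₂ = solve-∀ ℚ-ring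
  lemma₃ : ∀ x y z → x * (y * z) ≡ y * (x * z)
  lemma₃ = solve-∀ ℚ-ring

^-eventually-< : ∀ {ρ δ} → 0ℚ < ρ → ρ < 1ℚ → 0ℚ < δ → ∃[ N ] ∀ n → N ℕ.≤ n → ρ ^ n < δ
^-eventually-< {ρ} {δ} 0<ρ ρ<1 0<δ = let N , bound = geometric-dominates {u = 1ℚ} 0<ρ ρ<1 0<δ in
  N , λ n N≤n → subst₂ _<_ (*-identityˡ (ρ ^ n))
    (trans (cong (δ *_) (1^n≡1 n)) (*-identityʳ δ)) (bound n N≤n)

-- From growth of the coefficients to the radius of convergence.

-- The inequality limsup ≤ 1 for the n-th roots of `f (a n)`, with the roots cleared;
-- `FrequentlyAbovePowers` is limsup ≥ 1. The strict `N < n` matches the tails in `limsup`.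
EventuallyBelowPowers : (ℚ → ℚ) → (ℕ → ℚ) → Set
EventuallyBelowPowers f a = ∀ c → 1ℚ < c → ∃[ N ] ∀ n → N ℕ.< n → f (a n) < c ^ n

FrequentlyAbovePowers : (ℚ → ℚ) → (ℕ → ℚ) → Set
FrequentlyAbovePowers f a = ∀ c → 0ℚ < c → c < 1ℚ → ∀ N → ∃[ n ] N ℕ.< n × c ^ n < f (a n)

0<½ : 0ℚ < ½
0<½ = positive⁻¹ ½

½<1 : ½ < 1ℚ
½<1 = *<* (ℤ.+<+ (ℕ.s≤s (ℕ.s≤s ℕ.z≤n)))

-- Here `c` may be negative, whereas the lower growth property speaks only of positive bases; ½
-- takes over when `c` is too small for plain density.
<1⇒∃between : ∀ {c} → c < 1ℚ → ∃[ d ] c < d × 0ℚ < d × d < 1ℚ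
<1⇒∃between {c} c<1 with c <? ½
... | yes c<½ = ½ , c<½ , 0<½ , ½<1
... | no  c≮½ = let d , c<d , d<1 = <-dense c<1 in
  d , c<d , <-trans 0<½ (≤-<-trans (≮⇒≥ c≮½) c<d) , d<1

-- Cuts need not be located, so membership on each side is compared with 1 by deciding the order of
-- rationals. The intermediate rational in `sup` and `inf` leaves the room that turns a non-strict
-- comparison of `c` with 1 into a strict one.
radius≡1 : ∀ f a → EventuallyBelowPowers f a → FrequentlyAbovePowers f a → HasRadiusOfConvergence f a 1ℚ
radius≡1 f a upper lower c = mk⇔ below⇒<1 <1⇒below , mk⇔ above⇒>1 >1⇒above
  where
  L : Cut
  L = limsup (λ n → root n (f (a n)))
  below⇒<1 : Below L c → c < 1ℚ
  below⇒<1 (c′ , c<c′ , frequently) with c <? 1ℚ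
  ... | yes c<1 = c<1
  ... | no  c≮1 with 1<c′ ← ≤-<-trans (≮⇒≥ c≮1) c<c′ with upper c′ 1<c′
  ... | N , eventually with frequently N
  -- Negative rationals lie below every root by definition, but here `c′` exceeds 1.
  ... | (n , N<n) , inj₁ c′<0   = contradiction (<-trans (<-trans 0<1 1<c′) c′<0) (<-irrefl refl)
  ... | (n , N<n) , inj₂ c′ⁿ<fa = contradiction (<-trans c′ⁿ<fa (eventually n N<n)) (<-irrefl refl)
  <1⇒below : c < 1ℚ → Below L c
  <1⇒below c<1 = let d , c<d , 0<d , d<1 = <1⇒∃between c<1 in
    d , c<d , λ N → let n , N<n , dⁿ<fa = lower d 0<d d<1 N in (n , N<n) , inj₂ dⁿ<fa
  above⇒>1 : Above L c → 1ℚ < c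
  above⇒>1 (N , c′ , c′<c , eventually) with 1ℚ <? c
  ... | yes 1<c = 1<c
  -- The index `suc N` is consulted only for the positivity of `c′`, which is part of lying above a
  -- root.
  ... | no  1≮c with lower c′ (proj₁ (eventually (suc N , ℕ.≤-refl))) (<-≤-trans c′<c (≮⇒≥ 1≮c)) N
  ... | n , N<n , c′ⁿ<fa = contradiction (<-trans c′ⁿ<fa (proj₂ (eventually (n , N<n)))) (<-irrefl refl)
  >1⇒above : 1ℚ < c → Above L c
  >1⇒above 1<c = let d , 1<d , d<c = <-dense 1<c; N , eventually = upper d 1<d in
    N , d , d<c , λ (n , N<n) → <-trans 0<1 1<d , eventually n N<n

-- Absolute values and convergence of power series in the completion.

record IsAbsoluteValue (f : ℚ → ℚ) : Set where
  field
    abs≥0    : ∀ x → 0ℚ ≤ f x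
    definite : ∀ x → f x ≡ 0ℚ → x ≡ 0ℚ
    f0≡0     : f 0ℚ ≡ 0ℚ
    f1≡1     : f 1ℚ ≡ 1ℚ
    homo-*   : ∀ x y → f (x * y) ≡ f x * f y
    homo-neg : ∀ x → f (- x) ≡ f x
    triangle : ∀ x y → f (x + y) ≤ f x + f y

  homo-^ : ∀ x n → f (x ^ n) ≡ f x ^ n
  homo-^ x zero    = f1≡1
  homo-^ x (suc n) = trans (homo-* x (x ^ n)) (cong (f x *_) (homo-^ x n))

  positive-≢0 : ∀ {x} → x ≢ 0ℚ → 0ℚ < f x
  positive-≢0 {x} x≢0 with 0ℚ <? f x
  ... | yes 0<fx = 0<fx
  ... | no  0≮fx = contradiction (definite x (≤-antisym (≮⇒≥ 0≮fx) (abs≥0 x))) x≢0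

  swap : ∀ x y → f (x - y) ≡ f (y - x)
  swap x y = trans (cong f (lemma x y)) (homo-neg (y - x))
    where
    lemma : ∀ x y → x - y ≡ - (y - x)
    lemma = solve-∀ ℚ-ring

-- The limit is the sequence itself, viewed as a point of the completion. A `δ` strictly below `ε`
-- supplies the margin that `DistanceLessThan` requires.
cauchy⇒convergent : ∀ {f} s → IsCauchy f s → ∃[ y ] ConvergesTo f s y
cauchy⇒convergent s cauchy-s = record { seq = s ; cauchy = cauchy-s } , λ ε 0<ε →
  let δ , 0<δ , δ<ε = <-dense 0<ε; N , close = cauchy-s δ 0<δ in
  N , λ n N≤n → δ , δ<ε , N , λ m N≤m → <⇒≤ (close n m N≤n N≤m)

module _ {f} (isAbs : IsAbsoluteValue f) where
  open IsAbsoluteValue isAbs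

  -- The triangle inequality bounds a tail by a geometric sum, at most `ρ ^ n` divided by `1ℚ - ρ`.
  -- Carrying the factor `1ℚ - ρ` along makes that sum telescope without division.
  geometric-increments⇒cauchy : ∀ {s ρ} → 0ℚ < ρ → ρ < 1ℚ →
    ∃[ N ] (∀ n → N ℕ.≤ n → f (s (suc n) - s n) ≤ ρ ^ n) → IsCauchy f s
  geometric-increments⇒cauchy {s} {ρ} 0<ρ ρ<1 (N₁ , increment) ε 0<ε =
    N₁ ℕ.⊔ N₂ , λ m n N≤m N≤n → [ (λ n≤m → close m n N≤n n≤m)
                                , (λ m≤n → subst (_< ε) (swap (s n) (s m)) (close n m N≤m m≤n))
                                ]′ (ℕ.≤-total n m)
    where
    open ≤-Reasoning
    0<1-ρ : 0ℚ < 1ℚ - ρ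
    0<1-ρ = p<q⇒0<q-p ρ<1
    small : ∃[ N ] ∀ n → N ℕ.≤ n → ρ ^ n < (1ℚ - ρ) * ε
    small = ^-eventually-< 0<ρ ρ<1 (0<* 0<1-ρ 0<ε)
    N₂ : ℕ
    N₂ = proj₁ small
    telescope : ∀ n j → N₁ ℕ.≤ n → (1ℚ - ρ) * f (s (j ℕ.+ n) - s n) ≤ ρ ^ n - ρ ^ (j ℕ.+ n)
    telescope n zero _ = begin
      (1ℚ - ρ) * f (s n - s n) ≡⟨ cong (λ x → (1ℚ - ρ) * f x) (+-inverseʳ (s n)) ⟩
      (1ℚ - ρ) * f 0ℚ          ≡⟨ trans (cong ((1ℚ - ρ) *_) f0≡0) (*-zeroʳ (1ℚ - ρ)) ⟩
      0ℚ                       ≡⟨ +-inverseʳ (ρ ^ n) ⟨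
      ρ ^ n - ρ ^ n            ∎
    telescope n (suc j) N₁≤n = begin
      (1ℚ - ρ) * f (s (suc k) - s n)                               ≡⟨ cong (λ x → (1ℚ - ρ) * f x) (lemma₁ (s (suc k)) (s k) (s n)) ⟩
      (1ℚ - ρ) * f ((s (suc k) - s k) + (s k - s n))               ≤⟨ *-monoˡ-≤ (<⇒≤ 0<1-ρ) (triangle (s (suc k) - s k) (s k - s n)) ⟩
      (1ℚ - ρ) * (f (s (suc k) - s k) + f (s k - s n))             ≡⟨ *-distribˡ-+ (1ℚ - ρ) (f (s (suc k) - s k)) (f (s k - s n)) ⟩
      (1ℚ - ρ) * f (s (suc k) - s k) + (1ℚ - ρ) * f (s k - s n)    ≤⟨ +-mono-≤ (*-monoˡ-≤ (<⇒≤ 0<1-ρ) (increment k (ℕ.≤-trans N₁≤n (ℕ.m≤n+m n j)))) (telescope n j N₁≤n) ⟩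
      (1ℚ - ρ) * ρ ^ k + (ρ ^ n - ρ ^ k)                           ≡⟨ lemma₂ ρ (ρ ^ k) (ρ ^ n) ⟩
      ρ ^ n - ρ * ρ ^ k                                            ∎
      where
      k : ℕ
      k = j ℕ.+ n
      lemma₁ : ∀ x y z → x - z ≡ (x - y) + (y - z)
      lemma₁ = solve-∀ ℚ-ring
      lemma₂ : ∀ r x y → (1ℚ - r) * x + (y - x) ≡ y - r * x
      lemma₂ = solve-∀ ℚ-ring
    close : ∀ m n → N₁ ℕ.⊔ N₂ ℕ.≤ n → n ℕ.≤ m → f (s m - s n) < ε
    close m n N≤n n≤m = *-cancelˡ-< 0<1-ρ (begin-strict
      (1ℚ - ρ) * f (s m - s n)                 ≡⟨ cong (λ k → (1ℚ - ρ) * f (s k - s n)) (ℕ.m∸n+n≡m n≤m) ⟨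
      (1ℚ - ρ) * f (s (m ℕ.∸ n ℕ.+ n) - s n)   ≤⟨ telescope n (m ℕ.∸ n) (ℕ.m⊔n≤o⇒m≤o N₁ N₂ N≤n) ⟩
      ρ ^ n - ρ ^ (m ℕ.∸ n ℕ.+ n)              ≤⟨ 0≤⇒p≤p+q (0≤^ (<⇒≤ 0<ρ) (m ℕ.∸ n ℕ.+ n)) ⟩
      ρ ^ n - ρ ^ (m ℕ.∸ n ℕ.+ n) + ρ ^ (m ℕ.∸ n ℕ.+ n) ≡⟨ lemma (ρ ^ n) (ρ ^ (m ℕ.∸ n ℕ.+ n)) ⟩
      ρ ^ n                                    <⟨ proj₂ small n (ℕ.m⊔n≤o⇒n≤o N₁ N₂ N≤n) ⟩
      (1ℚ - ρ) * ε                             ∎)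
      where
      lemma : ∀ x y → x - y + y ≡ x
      lemma = solve-∀ ℚ-ring

  -- The root test: for `c > 1` close enough to 1 the product of `c` and `f x` stays below some
  -- `ρ < 1`, and the terms of the series are eventually at most `ρ ^ n`.
  openDisc⊆convergenceSet : ∀ {a x} → EventuallyBelowPowers f a → f x < 1ℚ → ConvergenceSet f a x
  openDisc⊆convergenceSet {a} {x} upper r<1 = cauchy⇒convergent (partialSum a x)
    (geometric-increments⇒cauchy {s = partialSum a x} 0<ρ ρ<1 (suc (proj₁ bound) , increment))
    where
    open ≤-Reasoning
    r ρ c : ℚ
    r = f x
    -- The midpoint of `r` and 1, hence positive even when `r` is 0.
    ρ = ½ * (1ℚ + r)
    -- The radius c is chosen so that ρ - c r = ½ (1 - r)².
    c = 1ℚ + ½ * (1ℚ - r)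
    0<1-r : 0ℚ < 1ℚ - r
    0<1-r = p<q⇒0<q-p r<1
    0<ρ : 0ℚ < ρ
    0<ρ = 0<* 0<½ (<-≤-trans 0<1 (0≤⇒p≤p+q (abs≥0 x)))
    ρ<1 : ρ < 1ℚ
    ρ<1 = *-monoˡ-< 0<½ (+-monoʳ-< 1ℚ r<1)
    1<c : 1ℚ < c
    1<c = +-monoʳ-< 1ℚ (0<* 0<½ 0<1-r)
    cr≤ρ : c * r ≤ ρ
    cr≤ρ = subst (c * r ≤_) (lemma r) (0≤⇒p≤p+q (<⇒≤ (0<* 0<½ (0<* 0<1-r 0<1-r))))
      where
      lemma : ∀ r → (1ℚ + ½ * (1ℚ - r)) * r + ½ * ((1ℚ - r) * (1ℚ - r)) ≡ ½ * (1ℚ + r)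
      lemma = solve-∀ ℚ-ring
    bound : ∃[ N ] ∀ n → N ℕ.< n → f (a n) < c ^ n
    bound = upper c 1<c
    increment : ∀ n → proj₁ bound ℕ.< n → f (partialSum a x (suc n) - partialSum a x n) ≤ ρ ^ n
    increment n N<n = begin
      f (partialSum a x n + a n * x ^ n - partialSum a x n) ≡⟨ cong f (lemma (partialSum a x n) (a n * x ^ n)) ⟩
      f (a n * x ^ n)                                       ≡⟨ trans (homo-* (a n) (x ^ n)) (cong (f (a n) *_) (homo-^ x n)) ⟩
      f (a n) * r ^ n                                       ≤⟨ *-monoʳ-≤ (0≤^ (abs≥0 x) n) (<⇒≤ (proj₂ bound n N<n)) ⟩
      c ^ n * r ^ n                                         ≡⟨ ^-distrib-* c r n ⟨
      (c * r) ^ n                                           ≤⟨ ^-monoˡ-≤ (0≤* (<⇒≤ (<-trans 0<1 1<c)) (abs≥0 x)) cr≤ρ n ⟩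
      ρ ^ n                                                 ∎
      where
      lemma : ∀ x y → x + y - x ≡ y
      lemma = solve-∀ ℚ-ring

-- Binomial coefficients: recursion and non-vanishing.

binomialCoeff*n! : ∀ b n → binomialCoeff b n * fromℕ (n !) ≡ fallingFactorial b n
binomialCoeff*n! b n = trans (*-assoc (fallingFactorial b n) _ (fromℕ (n !)))
  (trans (cong (fallingFactorial b n *_) ([i/n]*n≡i 1ℤ (n !) {{n ℕ.!≢0}})) (*-identityʳ (fallingFactorial b n)))

0<fromℕ[n!] : ∀ n → 0ℚ < fromℕ (n !)
0<fromℕ[n!] n = 0<fromℕ (n !) {{n ℕ.!≢0}}

binomialCoeff-suc : ∀ b n → binomialCoeff b (suc n) * fromℕ (suc n) ≡ binomialCoeff b n * (b - fromℕ n)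
binomialCoeff-suc b n = *-cancelʳ-≡ (0<fromℕ[n!] n) (begin
  binomialCoeff b (suc n) * fromℕ (suc n) * fromℕ (n !)   ≡⟨ *-assoc (binomialCoeff b (suc n)) (fromℕ (suc n)) (fromℕ (n !)) ⟩
  binomialCoeff b (suc n) * (fromℕ (suc n) * fromℕ (n !)) ≡⟨ cong (binomialCoeff b (suc n) *_) (fromℕ-homo-* (suc n) (n !)) ⟨
  binomialCoeff b (suc n) * fromℕ (suc n !)               ≡⟨ binomialCoeff*n! b (suc n) ⟩
  fallingFactorial b n * (b - fromℕ n)                    ≡⟨ cong (_* (b - fromℕ n)) (binomialCoeff*n! b n) ⟨
  binomialCoeff b n * fromℕ (n !) * (b - fromℕ n)         ≡⟨ lemma (binomialCoeff b n) (fromℕ (n !)) (b - fromℕ n) ⟩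
  binomialCoeff b n * (b - fromℕ n) * fromℕ (n !)         ∎)
  where
  open ≡-Reasoning
  lemma : ∀ x y z → x * y * z ≡ x * z * y
  lemma = solve-∀ ℚ-ring

x*y≢0 : ∀ {x y} → x ≢ 0ℚ → y ≢ 0ℚ → x * y ≢ 0ℚ
x*y≢0 {x} {y} x≢0 y≢0 xy≡0 = y≢0 (begin
  y                ≡⟨ *-identityˡ y ⟨
  1ℚ * y           ≡⟨ cong (_* y) (*-inverseˡ x) ⟨
  1/ x * x * y     ≡⟨ *-assoc (1/ x) x y ⟩
  1/ x * (x * y)   ≡⟨ cong (1/ x *_) xy≡0 ⟩
  1/ x * 0ℚ        ≡⟨ *-zeroʳ (1/ x) ⟩
  0ℚ               ∎)
  where
  open ≡-Reasoning
  instance _ = ≢-nonZero x≢0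

x-y≡0⇒x≡y : ∀ {x y} → x - y ≡ 0ℚ → x ≡ y
x-y≡0⇒x≡y {x} {y} eq = trans (sym (p+[q-p]≡q y x)) (trans (cong (y +_) eq) (+-identityʳ y))

b-n≢0 : ∀ {b} → ¬ IsInteger b → ∀ n → b - fromℕ n ≢ 0ℚ
b-n≢0 b∉ℤ n eq = b∉ℤ (ℤ.+ n , x-y≡0⇒x≡y eq)

fallingFactorial≢0 : ∀ {b} → ¬ IsInteger b → ∀ n → fallingFactorial b n ≢ 0ℚ
fallingFactorial≢0 b∉ℤ zero    = 1≢0
fallingFactorial≢0 b∉ℤ (suc n) = x*y≢0 (fallingFactorial≢0 b∉ℤ n) (b-n≢0 b∉ℤ n)

binomialCoeff≢0 : ∀ {b} → ¬ IsInteger b → ∀ n → binomialCoeff b n ≢ 0ℚ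
binomialCoeff≢0 {b} b∉ℤ n eq = fallingFactorial≢0 b∉ℤ n
  (trans (sym (binomialCoeff*n! b n)) (trans (cong (_* fromℕ (n !)) eq) (*-zeroˡ (fromℕ (n !)))))

-- Growth for the usual absolute value.

∣∣-isAbsoluteValue : IsAbsoluteValue ∣_∣
∣∣-isAbsoluteValue = record
  { abs≥0    = 0≤∣p∣
  ; definite = ∣p∣≡0⇒p≡0
  ; f0≡0     = refl
  ; f1≡1     = refl
  ; homo-*   = ∣p*q∣≡∣p∣*∣q∣
  ; homo-neg = ∣-p∣≡∣p∣
  ; triangle = ∣p+q∣≤∣p∣+∣q∣
  }

-- From index `N` on, `u` grows at most like powers of `α` and `v` at least like powers of the
-- larger `β`. Treating two sequences symmetrically lets one test give both growth bounds, with
-- `c ^_` in the role of `v` or of `u`.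
ratio-test : ∀ {α β} (u v : ℕ → ℚ) N → 0ℚ < α → α < β → 0ℚ < v N →
  (∀ n → N ℕ.≤ n → u (suc n) ≤ α * u n) → (∀ n → N ℕ.≤ n → β * v n ≤ v (suc n)) →
  ∃[ M ] ∀ n → M ℕ.< n → u n < v n
-- Writing `n` as `(n ∸ N) + N`, the threshold `M + N` makes the exponent `n ∸ N` at least `M`.
ratio-test {α} {β} u v N 0<α α<β 0<vN u-ratio v-ratio = M ℕ.+ N , λ n M+N<n →
  subst (λ k → u k < v k) (ℕ.m∸n+n≡m (ℕ.≤-trans (ℕ.m≤n+m N M) (ℕ.<⇒≤ M+N<n)))
    (compare (n ℕ.∸ N) (ℕ.≤-trans (ℕ.≤-reflexive (sym (ℕ.m+n∸n≡m M N))) (ℕ.∸-monoˡ-≤ N (ℕ.<⇒≤ M+N<n))))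
  where
  open ≤-Reasoning
  dominate : ∃[ M ] ∀ n → M ℕ.≤ n → u N * α ^ n < v N * β ^ n
  dominate = geometric-dominates {u = u N} 0<α α<β 0<vN
  M : ℕ
  M = proj₁ dominate
  lemma : ∀ x y z → x * (y * z) ≡ y * (x * z)
  lemma = solve-∀ ℚ-ring
  u-bound : ∀ j → u (j ℕ.+ N) ≤ u N * α ^ j
  u-bound zero    = ≤-reflexive (sym (*-identityʳ (u N)))
  u-bound (suc j) = begin
    u (suc (j ℕ.+ N))  ≤⟨ u-ratio (j ℕ.+ N) (ℕ.m≤n+m N j) ⟩
    α * u (j ℕ.+ N)    ≤⟨ *-monoˡ-≤ (<⇒≤ 0<α) (u-bound j) ⟩
    α * (u N * α ^ j)  ≡⟨ lemma α (u N) (α ^ j) ⟩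
    u N * (α * α ^ j)  ∎
  v-bound : ∀ j → v N * β ^ j ≤ v (j ℕ.+ N)
  v-bound zero    = ≤-reflexive (*-identityʳ (v N))
  v-bound (suc j) = begin
    v N * (β * β ^ j)  ≡⟨ lemma (v N) β (β ^ j) ⟩
    β * (v N * β ^ j)  ≤⟨ *-monoˡ-≤ (<⇒≤ (<-trans 0<α α<β)) (v-bound j) ⟩
    β * v (j ℕ.+ N)    ≤⟨ v-ratio (j ℕ.+ N) (ℕ.m≤n+m N j) ⟩
    v (suc (j ℕ.+ N))  ∎
  compare : ∀ j → M ℕ.≤ j → u (j ℕ.+ N) < v (j ℕ.+ N)
  compare j M≤j = ≤-<-trans (u-bound j) (<-≤-trans (proj₂ dominate j M≤j) (v-bound j))

module _ (b : ℚ) where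
  open ≤-Reasoning
  open IsAbsoluteValue ∣∣-isAbsoluteValue using (homo-*; positive-≢0)

  private
    a : ℕ → ℚ
    a = binomialCoeff b

  ∣a∣-suc : ∀ n → ∣ a (suc n) ∣ * fromℕ (suc n) ≡ ∣ a n ∣ * ∣ b - fromℕ n ∣
  ∣a∣-suc n = begin-equality
    ∣ a (suc n) ∣ * fromℕ (suc n)     ≡⟨ cong (∣ a (suc n) ∣ *_) (0≤p⇒∣p∣≡p (0≤fromℕ (suc n))) ⟨
    ∣ a (suc n) ∣ * ∣ fromℕ (suc n) ∣ ≡⟨ homo-* (a (suc n)) (fromℕ (suc n)) ⟨
    ∣ a (suc n) * fromℕ (suc n) ∣     ≡⟨ cong ∣_∣ (binomialCoeff-suc b n) ⟩
    ∣ a n * (b - fromℕ n) ∣           ≡⟨ homo-* (a n) (b - fromℕ n) ⟩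
    ∣ a n ∣ * ∣ b - fromℕ n ∣         ∎

  ∣binomialCoeff∣-eventuallyBelowPowers : EventuallyBelowPowers ∣_∣ a
  ∣binomialCoeff∣-eventuallyBelowPowers c 1<c =
    ratio-test (λ n → ∣ a n ∣) (c ^_) N 0<α α<c (0<^ (<-trans 0<1 1<c) N) ratio (λ n _ → ≤-refl)
    where
    α : ℚ
    α = proj₁ (<-dense 1<c)
    1<α : 1ℚ < α
    1<α = proj₁ (proj₂ (<-dense 1<c))
    0<α : 0ℚ < α
    0<α = <-trans 0<1 1<α
    α<c : α < c
    α<c = proj₂ (proj₂ (<-dense 1<c))
    -- Chosen so that |b| + n, which bounds |b - n|, is at most α n.
    bound : ∃[ N ] ∀ n → N ℕ.≤ n → ∣ b ∣ < fromℕ n * (α - 1ℚ)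
    bound = archimedean ∣ b ∣ (p<q⇒0<q-p 1<α)
    N : ℕ
    N = proj₁ bound
    ∣b-n∣≤ : ∀ n → N ℕ.≤ n → ∣ b - fromℕ n ∣ ≤ α * fromℕ (suc n)
    ∣b-n∣≤ n N≤n = begin
      ∣ b - fromℕ n ∣                       ≤⟨ ∣p-q∣≤∣p∣+∣q∣ b (fromℕ n) ⟩
      ∣ b ∣ + ∣ fromℕ n ∣                   ≡⟨ cong (∣ b ∣ +_) (0≤p⇒∣p∣≡p (0≤fromℕ n)) ⟩
      ∣ b ∣ + fromℕ n                       ≤⟨ +-monoˡ-≤ (fromℕ n) (<⇒≤ (proj₂ bound n N≤n)) ⟩
      fromℕ n * (α - 1ℚ) + fromℕ n          ≤⟨ 0≤⇒p≤p+q (<⇒≤ 0<α) ⟩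
      fromℕ n * (α - 1ℚ) + fromℕ n + α      ≡⟨ lemma (fromℕ n) α ⟩
      α * (1ℚ + fromℕ n)                    ≡⟨ cong (α *_) (fromℕ-suc n) ⟨
      α * fromℕ (suc n)                     ∎
      where
      lemma : ∀ m α → m * (α - 1ℚ) + m + α ≡ α * (1ℚ + m)
      lemma = solve-∀ ℚ-ring
    ratio : ∀ n → N ℕ.≤ n → ∣ a (suc n) ∣ ≤ α * ∣ a n ∣
    ratio n N≤n = *-cancelʳ-≤ (0<fromℕ (suc n)) (begin
      ∣ a (suc n) ∣ * fromℕ (suc n)    ≡⟨ ∣a∣-suc n ⟩
      ∣ a n ∣ * ∣ b - fromℕ n ∣        ≤⟨ *-monoˡ-≤ (0≤∣p∣ (a n)) (∣b-n∣≤ n N≤n) ⟩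
      ∣ a n ∣ * (α * fromℕ (suc n))    ≡⟨ lemma ∣ a n ∣ α (fromℕ (suc n)) ⟩
      α * ∣ a n ∣ * fromℕ (suc n)      ∎)
      where
      lemma : ∀ x y z → x * (y * z) ≡ y * x * z
      lemma = solve-∀ ℚ-ring

  ∣binomialCoeff∣-eventuallyAbovePowers : ¬ IsInteger b → ∀ c → 0ℚ < c → c < 1ℚ → ∃[ N ] ∀ n → N ℕ.< n → c ^ n < ∣ a n ∣
  ∣binomialCoeff∣-eventuallyAbovePowers b∉ℤ c 0<c c<1 =
    ratio-test (c ^_) (λ n → ∣ a n ∣) N 0<c c<β (positive-≢0 (binomialCoeff≢0 b∉ℤ N)) (λ n _ → ≤-refl) ratio
    where
    β : ℚ
    β = proj₁ (<-dense c<1)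
    c<β : c < β
    c<β = proj₁ (proj₂ (<-dense c<1))
    β<1 : β < 1ℚ
    β<1 = proj₂ (proj₂ (<-dense c<1))
    -- A rearrangement of β (n + 1) < n - |b|, whose right side is at most |b - n|.
    bound : ∃[ N ] ∀ n → N ℕ.≤ n → ∣ b ∣ + β < fromℕ n * (1ℚ - β)
    bound = archimedean (∣ b ∣ + β) (p<q⇒0<q-p β<1)
    N : ℕ
    N = proj₁ bound
    ≤∣b-n∣ : ∀ n → N ℕ.≤ n → β * fromℕ (suc n) ≤ ∣ b - fromℕ n ∣
    ≤∣b-n∣ n N≤n = begin
      β * fromℕ (suc n)                               ≡⟨ cong (β *_) (fromℕ-suc n) ⟩
      β * (1ℚ + fromℕ n)                              ≡⟨ lemma₁ β (fromℕ n) ∣ b ∣ ⟩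
      ∣ b ∣ + β + (β * fromℕ n - ∣ b ∣)               ≤⟨ +-monoˡ-≤ (β * fromℕ n - ∣ b ∣) (<⇒≤ (proj₂ bound n N≤n)) ⟩
      fromℕ n * (1ℚ - β) + (β * fromℕ n - ∣ b ∣)      ≡⟨ lemma₂ (fromℕ n) β ∣ b ∣ ⟩
      fromℕ n - ∣ b ∣                                 ≡⟨ cong (_- ∣ b ∣) (0≤p⇒∣p∣≡p (0≤fromℕ n)) ⟨
      ∣ fromℕ n ∣ - ∣ b ∣                             ≡⟨ cong (λ x → ∣ x ∣ - ∣ b ∣) (lemma₃ (fromℕ n) b) ⟩
      ∣ b - (b - fromℕ n) ∣ - ∣ b ∣                   ≤⟨ +-monoˡ-≤ (- ∣ b ∣) (∣p-q∣≤∣p∣+∣q∣ b (b - fromℕ n)) ⟩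
      ∣ b ∣ + ∣ b - fromℕ n ∣ - ∣ b ∣                 ≡⟨ lemma₄ ∣ b ∣ ∣ b - fromℕ n ∣ ⟩
      ∣ b - fromℕ n ∣                                 ∎
      where
      lemma₁ : ∀ β m B → β * (1ℚ + m) ≡ B + β + (β * m - B)
      lemma₁ = solve-∀ ℚ-ring
      lemma₂ : ∀ m β B → m * (1ℚ - β) + (β * m - B) ≡ m - B
      lemma₂ = solve-∀ ℚ-ring
      lemma₃ : ∀ m b → m ≡ b - (b - m)
      lemma₃ = solve-∀ ℚ-ring
      lemma₄ : ∀ x y → x + y - x ≡ y
      lemma₄ = solve-∀ ℚ-ring
    ratio : ∀ n → N ℕ.≤ n → β * ∣ a n ∣ ≤ ∣ a (suc n) ∣
    ratio n N≤n = *-cancelʳ-≤ (0<fromℕ (suc n)) (begin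
      β * ∣ a n ∣ * fromℕ (suc n)      ≡⟨ lemma β ∣ a n ∣ (fromℕ (suc n)) ⟩
      ∣ a n ∣ * (β * fromℕ (suc n))    ≤⟨ *-monoˡ-≤ (0≤∣p∣ (a n)) (≤∣b-n∣ n N≤n) ⟩
      ∣ a n ∣ * ∣ b - fromℕ n ∣        ≡⟨ ∣a∣-suc n ⟨
      ∣ a (suc n) ∣ * fromℕ (suc n)    ∎)
      where
      lemma : ∀ x y z → x * y * z ≡ y * (x * z)
      lemma = solve-∀ ℚ-ring

  ∣binomialCoeff∣-frequentlyAbovePowers : ¬ IsInteger b → FrequentlyAbovePowers ∣_∣ a
  ∣binomialCoeff∣-frequentlyAbovePowers b∉ℤ c 0<c c<1 N = let M , above = ∣binomialCoeff∣-eventuallyAbovePowers b∉ℤ c 0<c c<1 in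
    suc (M ℕ.+ N) , ℕ.s≤s (ℕ.m≤n+m N M) , above (suc (M ℕ.+ N)) (ℕ.s≤s (ℕ.m≤m+n M N))

-- Identities for falling factorials.

-- The recursive definition splits off the last factor; an induction that raises the argument
-- together with the length has to split off the first one.
fallingFactorial-shift : ∀ x n → fallingFactorial (1ℚ + x) (suc n) ≡ (1ℚ + x) * fallingFactorial x n
fallingFactorial-shift x zero    = lemma (1ℚ + x)
  where
  lemma : ∀ y → 1ℚ * (y - 0ℚ) ≡ y * 1ℚ
  lemma = solve-∀ ℚ-ring
fallingFactorial-shift x (suc n) = begin
  fallingFactorial (1ℚ + x) (suc n) * (1ℚ + x - fromℕ (suc n))      ≡⟨ cong₂ (λ y z → y * (1ℚ + x - z)) (fallingFactorial-shift x n) (fromℕ-suc n) ⟩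
  (1ℚ + x) * fallingFactorial x n * (1ℚ + x - (1ℚ + fromℕ n))       ≡⟨ lemma x (fallingFactorial x n) (fromℕ n) ⟩
  (1ℚ + x) * (fallingFactorial x n * (x - fromℕ n))                 ∎
  where
  open ≡-Reasoning
  lemma : ∀ x F m → (1ℚ + x) * F * (1ℚ + x - (1ℚ + m)) ≡ (1ℚ + x) * (F * (x - m))
  lemma = solve-∀ ℚ-ring

-- Pascal's rule multiplied by (n + 1)!, hence free of denominators.
fallingFactorial-pascal : ∀ x n →
  fallingFactorial (1ℚ + x) (suc n) ≡ fallingFactorial x (suc n) + fromℕ (suc n) * fallingFactorial x n
fallingFactorial-pascal x n = begin
  fallingFactorial (1ℚ + x) (suc n)                                       ≡⟨ fallingFactorial-shift x n ⟩
  (1ℚ + x) * F                                                            ≡⟨ lemma x F (fromℕ n) ⟩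
  F * (x - fromℕ n) + (1ℚ + fromℕ n) * F                                  ≡⟨ cong (λ m → F * (x - fromℕ n) + m * F) (fromℕ-suc n) ⟨
  F * (x - fromℕ n) + fromℕ (suc n) * F                                   ∎
  where
  open ≡-Reasoning
  F : ℚ
  F = fallingFactorial x n
  lemma : ∀ x F m → (1ℚ + x) * F ≡ F * (x - m) + (1ℚ + m) * F
  lemma = solve-∀ ℚ-ring

fallingFactorial-0 : ∀ n → fallingFactorial 0ℚ (suc n) ≡ 0ℚ
fallingFactorial-0 zero    = refl
fallingFactorial-0 (suc n) = trans (cong (_* (0ℚ - fromℕ (suc n))) (fallingFactorial-0 n)) (*-zeroˡ (0ℚ - fromℕ (suc n)))

-- Integers and their quotients.

∣z/1∣≡ : ∀ z → ∣ z / 1 ∣ ≡ fromℕ ℤ.∣ z ∣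
∣z/1∣≡ (ℤ.+ n)    = 0≤p⇒∣p∣≡p (0≤fromℕ n)
∣z/1∣≡ ℤ.-[1+ n ] = trans (∣-p∣≡∣p∣ (fromℕ (suc n))) (0≤p⇒∣p∣≡p (0≤fromℕ (suc n)))

[u/v]*v≡u : ∀ u v .{{_ : ℤ.NonZero v}} → (u /ᶻ v) * (v / 1) ≡ u / 1
[u/v]*v≡u u ℤ.+[1+ n ] = [i/n]*n≡i u (suc n)
[u/v]*v≡u u ℤ.-[1+ n ] = begin
  (ℤ.- u) / suc n * - fromℕ (suc n)    ≡⟨ neg-distribʳ-* ((ℤ.- u) / suc n) (fromℕ (suc n)) ⟨
  - ((ℤ.- u) / suc n * fromℕ (suc n))  ≡⟨ cong -_ ([i/n]*n≡i (ℤ.- u) (suc n)) ⟩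
  - ((ℤ.- u) / 1)                      ≡⟨ /1-homo-neg (ℤ.- u) ⟨
  (ℤ.- ℤ.- u) / 1                      ≡⟨ cong (_/ 1) (ℤ.neg-involutive u) ⟩
  u / 1                                ∎
  where open ≡-Reasoning

-- The p-adic valuation of natural numbers.

maxExponent≤-∣ : ∀ k p n → p ℕ.^ maxExponent≤ k p n ℕ.∣ n
maxExponent≤-∣ zero    p n = ℕ.1∣ n
maxExponent≤-∣ (suc k) p n with p ℕ.^ suc k ℕ.∣? n
... | yes p^∣n = p^∣n
... | no  _    = maxExponent≤-∣ k p n

maxExponent≤-maximal : ∀ k p n j → j ℕ.≤ k → p ℕ.^ j ℕ.∣ n → j ℕ.≤ maxExponent≤ k p n
maxExponent≤-maximal zero    p n j j≤k _ = j≤k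
maxExponent≤-maximal (suc k) p n j j≤1+k p^j∣n with p ℕ.^ suc k ℕ.∣? n
... | yes _    = j≤1+k
... | no  p^∤n = maxExponent≤-maximal k p n j
  (ℕ.≤-pred (ℕ.≤∧≢⇒< j≤1+k λ { refl → p^∤n p^j∣n })) p^j∣n

m≤n⇒p^m∣p^n : ∀ p {m n} → m ℕ.≤ n → p ℕ.^ m ℕ.∣ p ℕ.^ n
m≤n⇒p^m∣p^n p {m} {n} m≤n = ℕ.divides (p ℕ.^ (n ℕ.∸ m))
  (trans (cong (p ℕ.^_) (sym (ℕ.m∸n+n≡m m≤n))) (ℕ.^-distribˡ-+-* p (n ℕ.∸ m) m))

coprime-^ʳ : ∀ {m n} → ℕ.Coprime m n → ∀ k → ℕ.Coprime m (n ℕ.^ k)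
coprime-^ʳ c zero    (_ , d∣1) = ℕ.∣1⇒≡1 d∣1
coprime-^ʳ c (suc k) (d∣m , d∣n*n^k) = coprime-^ʳ c k
  (d∣m , ℕ.coprime-divisor (λ (e∣d , e∣n) → c (ℕ.∣-trans e∣d d∣m , e∣n)) d∣n*n^k)

module _ {p : ℕ} (p-prime : Prime p) where
  private instance
    p≢0 : ℕ.NonZero p
    p≢0 = prime⇒nonZero p-prime

  1<p : 1 ℕ.< p
  1<p = ℕ.nonTrivial⇒n>1 p {{prime⇒nonTrivial p-prime}}

  ν : ℕ → ℕ
  ν = multiplicity p

  p^ν∣n : ∀ n → p ℕ.^ ν n ℕ.∣ n
  p^ν∣n n = maxExponent≤-∣ n p n

  n<p^n : ∀ n → n ℕ.< p ℕ.^ n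
  n<p^n zero    = ℕ.≤-refl
  n<p^n (suc n) = ℕ.≤-<-trans (n<p^n n) (ℕ.^-monoʳ-< p 1<p (ℕ.n<1+n n))

  p^j∣n⇒j≤ν : ∀ j n .{{_ : ℕ.NonZero n}} → p ℕ.^ j ℕ.∣ n → j ℕ.≤ ν n
  p^j∣n⇒j≤ν j n p^j∣n = maxExponent≤-maximal n p n j
    (ℕ.<⇒≤ (ℕ.<-≤-trans (n<p^n j) (ℕ.∣⇒≤ p^j∣n))) p^j∣n

  p∤n/p^ν : ∀ n .{{_ : ℕ.NonZero n}} → ¬ p ℕ.∣ ℕ.quotient (p^ν∣n n)
  p∤n/p^ν n p∣q = ℕ.n≮n (ν n) (p^j∣n⇒j≤ν (suc (ν n)) n
    (subst (p ℕ.^ suc (ν n) ℕ.∣_) (sym (ℕ.m∣n⇒n≡quotient*m (p^ν∣n n))) (ℕ.*-monoˡ-∣ (p ℕ.^ ν n) p∣q)))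

  -- The exponents add because the cofactors left after removing the powers of `p` are prime to `p`:
  -- a larger exponent would make `p` divide their product, against Euclid's lemma.
  ν-homo-* : ∀ m n .{{_ : ℕ.NonZero m}} .{{_ : ℕ.NonZero n}} → ν (m ℕ.* n) ≡ ν m ℕ.+ ν n
  ν-homo-* m n = ℕ.≤-antisym (ℕ.≮⇒≥ too-large)
    (p^j∣n⇒j≤ν (ν m ℕ.+ ν n) (m ℕ.* n) (subst (ℕ._∣ m ℕ.* n) (sym (ℕ.^-distribˡ-+-* p (ν m) (ν n)))
      (ℕ.*-pres-∣ (p^ν∣n m) (p^ν∣n n))))
    where
    instance
      _ = ℕ.m*n≢0 m n
      _ = ℕ.m^n≢0 p (ν m ℕ.+ ν n)
    q r : ℕ
    q = ℕ.quotient (p^ν∣n m)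
    r = ℕ.quotient (p^ν∣n n)
    mn≡ : m ℕ.* n ≡ q ℕ.* r ℕ.* p ℕ.^ (ν m ℕ.+ ν n)
    mn≡ = begin
      m ℕ.* n                                       ≡⟨ cong₂ ℕ._*_ (ℕ.m∣n⇒n≡quotient*m (p^ν∣n m)) (ℕ.m∣n⇒n≡quotient*m (p^ν∣n n)) ⟩
      (q ℕ.* p ℕ.^ ν m) ℕ.* (r ℕ.* p ℕ.^ ν n)       ≡⟨ ℕ.[m*n]*[o*p]≡[m*o]*[n*p] q (p ℕ.^ ν m) r (p ℕ.^ ν n) ⟩
      q ℕ.* r ℕ.* (p ℕ.^ ν m ℕ.* p ℕ.^ ν n)         ≡⟨ cong (q ℕ.* r ℕ.*_) (ℕ.^-distribˡ-+-* p (ν m) (ν n)) ⟨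
      q ℕ.* r ℕ.* p ℕ.^ (ν m ℕ.+ ν n)               ∎
      where open ≡-Reasoning
    too-large : ¬ ν m ℕ.+ ν n ℕ.< ν (m ℕ.* n)
    too-large lt = [ p∤n/p^ν m , p∤n/p^ν n ]′ (euclidsLemma q r p-prime
      (ℕ.*-cancelʳ-∣ (p ℕ.^ (ν m ℕ.+ ν n)) (subst (p ℕ.^ suc (ν m ℕ.+ ν n) ℕ.∣_) mn≡
        (ℕ.∣-trans (m≤n⇒p^m∣p^n p lt) (p^ν∣n (m ℕ.* n))))))

  -- The p-adic absolute value on the rationals.

  ∣_∣ₚ : ℚ → ℚ
  ∣_∣ₚ = padicAbs p-prime

  0<p^ : ∀ k → 0ℚ < fromℕ (p ℕ.^ k)
  0<p^ k = 0<fromℕ (p ℕ.^ k) {{ℕ.m^n≢0 p k}}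

  fromℕ-p^+ : ∀ k l → fromℕ (p ℕ.^ (k ℕ.+ l)) ≡ fromℕ (p ℕ.^ k) * fromℕ (p ℕ.^ l)
  fromℕ-p^+ k l = trans (cong fromℕ (ℕ.^-distribˡ-+-* p k l)) (fromℕ-homo-* (p ℕ.^ k) (p ℕ.^ l))

  ∣x∣ₚ*p^ν↥≡p^ν↧ : ∀ x .{{_ : ℕ.NonZero ℤ.∣ ↥ x ∣}} → ∣ x ∣ₚ * fromℕ (p ℕ.^ ν ℤ.∣ ↥ x ∣) ≡ fromℕ (p ℕ.^ ν (↧ₙ x))
  ∣x∣ₚ*p^ν↥≡p^ν↧ (mkℚ ℤ.+[1+ n ] d _) = [i/n]*n≡i (ℤ.+ (p ℕ.^ ν (suc d))) (p ℕ.^ ν (suc n)) {{ℕ.m^n≢0 p (ν (suc n))}}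
  ∣x∣ₚ*p^ν↥≡p^ν↧ (mkℚ ℤ.-[1+ n ] d _) = [i/n]*n≡i (ℤ.+ (p ℕ.^ ν (suc d))) (p ℕ.^ ν (suc n)) {{ℕ.m^n≢0 p (ν (suc n))}}

  -- `padicAbs` is computed from lowest terms, but a product arrives as an unreduced fraction.
  -- Cross-multiplying with the lowest terms and adding valuations shows that any fraction may be
  -- used.
  ∣x∣ₚ*p^ν≡p^ν : ∀ x z d .{{_ : ℕ.NonZero ℤ.∣ z ∣}} .{{_ : ℕ.NonZero d}} → x * fromℕ d ≡ z / 1 →
    ∣ x ∣ₚ * fromℕ (p ℕ.^ ν ℤ.∣ z ∣) ≡ fromℕ (p ℕ.^ ν d)
  ∣x∣ₚ*p^ν≡p^ν x z d xd≡z = *-cancelʳ-≡ (0<p^ (ν (↧ₙ x))) (begin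
    ∣ x ∣ₚ * fromℕ (p ℕ.^ ν ℤ.∣ z ∣) * fromℕ (p ℕ.^ ν (↧ₙ x))      ≡⟨ lemma₁ ∣ x ∣ₚ (fromℕ (p ℕ.^ ν ℤ.∣ z ∣)) (fromℕ (p ℕ.^ ν (↧ₙ x))) ⟩
    ∣ x ∣ₚ * (fromℕ (p ℕ.^ ν ℤ.∣ z ∣) * fromℕ (p ℕ.^ ν (↧ₙ x)))    ≡⟨ cong (∣ x ∣ₚ *_) (fromℕ-p^+ (ν ℤ.∣ z ∣) (ν (↧ₙ x))) ⟨
    ∣ x ∣ₚ * fromℕ (p ℕ.^ (ν ℤ.∣ z ∣ ℕ.+ ν (↧ₙ x)))                ≡⟨ cong (λ k → ∣ x ∣ₚ * fromℕ (p ℕ.^ k)) ν-cross ⟨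
    ∣ x ∣ₚ * fromℕ (p ℕ.^ (ν ℤ.∣ ↥ x ∣ ℕ.+ ν d))                   ≡⟨ cong (∣ x ∣ₚ *_) (fromℕ-p^+ (ν ℤ.∣ ↥ x ∣) (ν d)) ⟩
    ∣ x ∣ₚ * (fromℕ (p ℕ.^ ν ℤ.∣ ↥ x ∣) * fromℕ (p ℕ.^ ν d))       ≡⟨ *-assoc ∣ x ∣ₚ _ (fromℕ (p ℕ.^ ν d)) ⟨
    ∣ x ∣ₚ * fromℕ (p ℕ.^ ν ℤ.∣ ↥ x ∣) * fromℕ (p ℕ.^ ν d)         ≡⟨ cong (_* fromℕ (p ℕ.^ ν d)) (∣x∣ₚ*p^ν↥≡p^ν↧ x) ⟩
    fromℕ (p ℕ.^ ν (↧ₙ x)) * fromℕ (p ℕ.^ ν d)                     ≡⟨ *-comm (fromℕ (p ℕ.^ ν (↧ₙ x))) (fromℕ (p ℕ.^ ν d)) ⟩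
    fromℕ (p ℕ.^ ν d) * fromℕ (p ℕ.^ ν (↧ₙ x))                     ∎)
    where
    open ≡-Reasoning
    lemma₁ : ∀ x y z → x * y * z ≡ x * (y * z)
    lemma₁ = solve-∀ ℚ-ring
    lemma₂ : ∀ x y z → x * y * z ≡ x * z * y
    lemma₂ = solve-∀ ℚ-ring
    cross : ↥ x ℤ.* ℤ.+ d ≡ z ℤ.* ↧ x
    cross = /1-injective (begin
      (↥ x ℤ.* ℤ.+ d) / 1          ≡⟨ /1-homo-* (↥ x) (ℤ.+ d) ⟩
      (↥ x) / 1 * fromℕ d          ≡⟨ cong (_* fromℕ d) (x*↧x≡↥x x) ⟨
      x * fromℕ (↧ₙ x) * fromℕ d   ≡⟨ lemma₂ x (fromℕ (↧ₙ x)) (fromℕ d) ⟩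
      x * fromℕ d * fromℕ (↧ₙ x)   ≡⟨ cong (_* fromℕ (↧ₙ x)) xd≡z ⟩
      z / 1 * fromℕ (↧ₙ x)         ≡⟨ /1-homo-* z (↧ x) ⟨
      (z ℤ.* ↧ x) / 1              ∎)
    cross-∣∣ : ℤ.∣ ↥ x ∣ ℕ.* d ≡ ℤ.∣ z ∣ ℕ.* ↧ₙ x
    cross-∣∣ = trans (sym (ℤ.abs-* (↥ x) (ℤ.+ d))) (trans (cong ℤ.∣_∣ cross) (ℤ.abs-* z (↧ x)))
    instance
      ∣↥x∣≢0 : ℕ.NonZero ℤ.∣ ↥ x ∣
      ∣↥x∣≢0 = ℕ.m*n≢0⇒m≢0 ℤ.∣ ↥ x ∣ {{subst ℕ.NonZero (sym cross-∣∣) (ℕ.m*n≢0 ℤ.∣ z ∣ (↧ₙ x))}}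
    ν-cross : ν ℤ.∣ ↥ x ∣ ℕ.+ ν d ≡ ν ℤ.∣ z ∣ ℕ.+ ν (↧ₙ x)
    ν-cross = trans (sym (ν-homo-* ℤ.∣ ↥ x ∣ d)) (trans (cong ν cross-∣∣) (ν-homo-* ℤ.∣ z ∣ (↧ₙ x)))

  ∣∣ₚ≥0 : ∀ x → 0ℚ ≤ ∣ x ∣ₚ
  ∣∣ₚ≥0 (mkℚ (ℤ.+ 0)     d _) = ≤-refl
  ∣∣ₚ≥0 (mkℚ ℤ.+[1+ n ] d _) = nonNegative⁻¹ _ {{normalize-nonNeg (p ℕ.^ ν (suc d)) (p ℕ.^ ν (suc n)) {{ℕ.m^n≢0 p (ν (suc n))}}}}
  ∣∣ₚ≥0 (mkℚ ℤ.-[1+ n ] d _) = nonNegative⁻¹ _ {{normalize-nonNeg (p ℕ.^ ν (suc d)) (p ℕ.^ ν (suc n)) {{ℕ.m^n≢0 p (ν (suc n))}}}}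

  ∣-x∣ₚ≡∣x∣ₚ : ∀ x → ∣ - x ∣ₚ ≡ ∣ x ∣ₚ
  ∣-x∣ₚ≡∣x∣ₚ (mkℚ (ℤ.+ 0)     d _) = refl
  ∣-x∣ₚ≡∣x∣ₚ (mkℚ ℤ.+[1+ n ] d _) = refl
  ∣-x∣ₚ≡∣x∣ₚ (mkℚ ℤ.-[1+ n ] d _) = refl

  x≢0⇒∣↥x∣≢0 : ∀ {x} → x ≢ 0ℚ → ℕ.NonZero ℤ.∣ ↥ x ∣
  x≢0⇒∣↥x∣≢0 {x} x≢0 = ℕ.≢-nonZero λ eq → x≢0 (↥p≡0⇒p≡0 x (ℤ.∣i∣≡0⇒i≡0 eq))

  ∣x∣ₚ≡0⇒x≡0 : ∀ x → ∣ x ∣ₚ ≡ 0ℚ → x ≡ 0ℚ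
  ∣x∣ₚ≡0⇒x≡0 x ∣x∣≡0 with x ≟ 0ℚ
  ... | yes x≡0 = x≡0
  ... | no  x≢0 = contradiction
    (trans (sym (*-zeroˡ (fromℕ (p ℕ.^ ν ℤ.∣ ↥ x ∣))))
      (trans (cong (_* fromℕ (p ℕ.^ ν ℤ.∣ ↥ x ∣)) (sym ∣x∣≡0)) (∣x∣ₚ*p^ν↥≡p^ν↧ x {{x≢0⇒∣↥x∣≢0 x≢0}})))
    (<⇒≢ (0<p^ (ν (↧ₙ x))))

  0<∣x∣ₚ : ∀ {x} → x ≢ 0ℚ → 0ℚ < ∣ x ∣ₚ
  0<∣x∣ₚ {x} x≢0 with 0ℚ <? ∣ x ∣ₚ
  ... | yes lt = lt
  ... | no  ge = contradiction (∣x∣ₚ≡0⇒x≡0 x (≤-antisym (≮⇒≥ ge) (∣∣ₚ≥0 x))) x≢0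

  ∣∣ₚ-homo-* : ∀ x y → ∣ x * y ∣ₚ ≡ ∣ x ∣ₚ * ∣ y ∣ₚ
  ∣∣ₚ-homo-* x y with x ≟ 0ℚ | y ≟ 0ℚ
  ... | yes refl | _ = trans (cong ∣_∣ₚ (*-zeroˡ y)) (sym (*-zeroˡ ∣ y ∣ₚ))
  ... | no _ | yes refl = trans (cong ∣_∣ₚ (*-zeroʳ x)) (sym (*-zeroʳ ∣ x ∣ₚ))
  ... | no x≢0 | no y≢0 = *-cancelʳ-≡ (0<p^ (ν n)) (begin
    ∣ x * y ∣ₚ * fromℕ (p ℕ.^ ν n)                          ≡⟨ ∣x∣ₚ*p^ν≡p^ν (x * y) (↥ x ℤ.* ↥ y) (↧ₙ x ℕ.* ↧ₙ y) xy-fraction ⟩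
    fromℕ (p ℕ.^ ν (↧ₙ x ℕ.* ↧ₙ y))                         ≡⟨ split (↧ₙ x) (↧ₙ y) ⟩
    fromℕ (p ℕ.^ ν (↧ₙ x)) * fromℕ (p ℕ.^ ν (↧ₙ y))         ≡⟨ cong₂ _*_ (∣x∣ₚ*p^ν↥≡p^ν↧ x) (∣x∣ₚ*p^ν↥≡p^ν↧ y) ⟨
    ∣ x ∣ₚ * fromℕ (p ℕ.^ ν ℤ.∣ ↥ x ∣) * (∣ y ∣ₚ * fromℕ (p ℕ.^ ν ℤ.∣ ↥ y ∣))
                                                            ≡⟨ interchange ∣ x ∣ₚ (fromℕ (p ℕ.^ ν ℤ.∣ ↥ x ∣)) ∣ y ∣ₚ (fromℕ (p ℕ.^ ν ℤ.∣ ↥ y ∣)) ⟩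
    ∣ x ∣ₚ * ∣ y ∣ₚ * (fromℕ (p ℕ.^ ν ℤ.∣ ↥ x ∣) * fromℕ (p ℕ.^ ν ℤ.∣ ↥ y ∣))
                                                            ≡⟨ cong (∣ x ∣ₚ * ∣ y ∣ₚ *_) (split ℤ.∣ ↥ x ∣ ℤ.∣ ↥ y ∣) ⟨
    ∣ x ∣ₚ * ∣ y ∣ₚ * fromℕ (p ℕ.^ ν (ℤ.∣ ↥ x ∣ ℕ.* ℤ.∣ ↥ y ∣)) ≡⟨ cong (λ k → ∣ x ∣ₚ * ∣ y ∣ₚ * fromℕ (p ℕ.^ ν k)) (ℤ.abs-* (↥ x) (↥ y)) ⟨
    ∣ x ∣ₚ * ∣ y ∣ₚ * fromℕ (p ℕ.^ ν n)                     ∎)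
    where
    open ≡-Reasoning
    n : ℕ
    n = ℤ.∣ ↥ x ℤ.* ↥ y ∣
    interchange : ∀ x y z w → x * y * (z * w) ≡ x * z * (y * w)
    interchange = solve-∀ ℚ-ring
    instance
      ∣↥x∣≢0 : ℕ.NonZero ℤ.∣ ↥ x ∣
      ∣↥x∣≢0 = x≢0⇒∣↥x∣≢0 x≢0
      ∣↥y∣≢0 : ℕ.NonZero ℤ.∣ ↥ y ∣
      ∣↥y∣≢0 = x≢0⇒∣↥x∣≢0 y≢0
      n≢0 : ℕ.NonZero n
      n≢0 = subst ℕ.NonZero (sym (ℤ.abs-* (↥ x) (↥ y))) (ℕ.m*n≢0 ℤ.∣ ↥ x ∣ ℤ.∣ ↥ y ∣)
    split : ∀ k l .{{_ : ℕ.NonZero k}} .{{_ : ℕ.NonZero l}} →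
      fromℕ (p ℕ.^ ν (k ℕ.* l)) ≡ fromℕ (p ℕ.^ ν k) * fromℕ (p ℕ.^ ν l)
    split k l = trans (cong (λ e → fromℕ (p ℕ.^ e)) (ν-homo-* k l)) (fromℕ-p^+ (ν k) (ν l))
    xy-fraction : x * y * fromℕ (↧ₙ x ℕ.* ↧ₙ y) ≡ (↥ x ℤ.* ↥ y) / 1
    xy-fraction = begin
      x * y * fromℕ (↧ₙ x ℕ.* ↧ₙ y)              ≡⟨ cong (x * y *_) (fromℕ-homo-* (↧ₙ x) (↧ₙ y)) ⟩
      x * y * (fromℕ (↧ₙ x) * fromℕ (↧ₙ y))      ≡⟨ interchange x y (fromℕ (↧ₙ x)) (fromℕ (↧ₙ y)) ⟩
      x * fromℕ (↧ₙ x) * (y * fromℕ (↧ₙ y))      ≡⟨ cong₂ _*_ (x*↧x≡↥x x) (x*↧x≡↥x y) ⟩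
      (↥ x) / 1 * ((↥ y) / 1)                    ≡⟨ /1-homo-* (↥ x) (↥ y) ⟨
      (↥ x ℤ.* ↥ y) / 1                          ∎

  ν1≡0 : ν 1 ≡ 0
  ν1≡0 with p ℕ.^ 1 ℕ.∣? 1
  ... | no  _   = refl
  ... | yes p∣1 = contradiction (trans (sym (ℕ.^-identityʳ p)) (ℕ.∣1⇒≡1 p∣1)) (ℕ.>⇒≢ 1<p)

  ∣z∣ₚ*p^ν≡1 : ∀ z .{{_ : ℕ.NonZero ℤ.∣ z ∣}} → ∣ z / 1 ∣ₚ * fromℕ (p ℕ.^ ν ℤ.∣ z ∣) ≡ 1ℚ
  ∣z∣ₚ*p^ν≡1 z = trans (∣x∣ₚ*p^ν≡p^ν (z / 1) z 1 (*-identityʳ (z / 1))) (cong (λ k → fromℕ (p ℕ.^ k)) ν1≡0)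

  -- With its converse below, a dictionary between p-adic size and divisibility; the product form
  -- covers `z = 0` and avoids negative powers of `p`.
  p^k∣z⇒∣z∣ₚ*p^k≤1 : ∀ k z → p ℕ.^ k ℕ.∣ ℤ.∣ z ∣ → ∣ z / 1 ∣ₚ * fromℕ (p ℕ.^ k) ≤ 1ℚ
  p^k∣z⇒∣z∣ₚ*p^k≤1 k z p^k∣z with z ℤ.≟ 0ℤ
  ... | yes refl = subst (_≤ 1ℚ) (sym (*-zeroˡ (fromℕ (p ℕ.^ k)))) (<⇒≤ 0<1)
  ... | no  z≢0 = subst (∣ z / 1 ∣ₚ * fromℕ (p ℕ.^ k) ≤_) (∣z∣ₚ*p^ν≡1 z)
    (*-monoˡ-≤ (∣∣ₚ≥0 (z / 1)) (fromℕ-mono-≤ {p ℕ.^ k} {p ℕ.^ ν ℤ.∣ z ∣} (ℕ.^-monoʳ-≤ p (p^j∣n⇒j≤ν k ℤ.∣ z ∣ p^k∣z))))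
    where instance _ = ℤ.≢-nonZero z≢0

  ∣z∣ₚ*p^k≤1⇒p^k∣z : ∀ k z → ∣ z / 1 ∣ₚ * fromℕ (p ℕ.^ k) ≤ 1ℚ → p ℕ.^ k ℕ.∣ ℤ.∣ z ∣
  ∣z∣ₚ*p^k≤1⇒p^k∣z k z ∣z∣p^k≤1 with z ℤ.≟ 0ℤ
  ... | yes refl = (p ℕ.^ k) ℕ.∣0
  ... | no  z≢0 with ν ℤ.∣ z ∣ ℕ.<? k
  ...   | no  ν≮k = ℕ.∣-trans (m≤n⇒p^m∣p^n p (ℕ.≮⇒≥ ν≮k)) (p^ν∣n ℤ.∣ z ∣)
  ...   | yes ν<k = contradiction
    (fromℕ-cancel-≤ {p ℕ.^ k} {p ℕ.^ ν ℤ.∣ z ∣} (*-cancelˡ-≤ (0<∣x∣ₚ {z / 1} λ eq → z≢0 (/1-injective eq))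
      (subst (∣ z / 1 ∣ₚ * fromℕ (p ℕ.^ k) ≤_) (sym (∣z∣ₚ*p^ν≡1 z)) ∣z∣p^k≤1)))
    (ℕ.<⇒≱ (ℕ.^-monoʳ-< p 1<p ν<k))
    where
    instance _ = ℤ.≢-nonZero z≢0

  ∣z∣ₚ≤1 : ∀ z → ∣ z / 1 ∣ₚ ≤ 1ℚ
  ∣z∣ₚ≤1 z = subst (_≤ 1ℚ) (*-identityʳ ∣ z / 1 ∣ₚ) (p^k∣z⇒∣z∣ₚ*p^k≤1 0 z (ℕ.1∣ ℤ.∣ z ∣))

  -- The exact power of `p` in `z` also divides `w`, since `w` is no larger p-adically, and so it
  -- divides the sum.
  ∣∣ₚ-ultrametric-ℤ : ∀ w z → ∣ w / 1 ∣ₚ ≤ ∣ z / 1 ∣ₚ → ∣ (w ℤ.+ z) / 1 ∣ₚ ≤ ∣ z / 1 ∣ₚ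
  ∣∣ₚ-ultrametric-ℤ w z ∣w∣≤∣z∣ with z ℤ.≟ 0ℤ
  ... | yes refl = subst (λ x → ∣ x / 1 ∣ₚ ≤ 0ℚ) (sym (ℤ.+-identityʳ w)) ∣w∣≤∣z∣
  ... | no  z≢0 = *-cancelʳ-≤ (0<p^ k) (subst (∣ (w ℤ.+ z) / 1 ∣ₚ * fromℕ (p ℕ.^ k) ≤_) (sym (∣z∣ₚ*p^ν≡1 z))
    (p^k∣z⇒∣z∣ₚ*p^k≤1 k (w ℤ.+ z) (Signed.∣⇒∣ᵤ (Signed.∣m∣n⇒∣m+n
      (Signed.∣ᵤ⇒∣ {ℤ.+ (p ℕ.^ k)} {w} (∣z∣ₚ*p^k≤1⇒p^k∣z k w (subst (∣ w / 1 ∣ₚ * fromℕ (p ℕ.^ k) ≤_) (∣z∣ₚ*p^ν≡1 z)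
        (*-monoʳ-≤ (<⇒≤ (0<p^ k)) ∣w∣≤∣z∣))))
      (Signed.∣ᵤ⇒∣ {ℤ.+ (p ℕ.^ k)} {z} (p^ν∣n ℤ.∣ z ∣))))))
    where
    instance _ = ℤ.≢-nonZero z≢0
    k : ℕ
    k = ν ℤ.∣ z ∣

  ∣n∣ₚ>0 : ∀ n .{{_ : ℕ.NonZero n}} → 0ℚ < ∣ fromℕ n ∣ₚ
  ∣n∣ₚ>0 n = 0<∣x∣ₚ {fromℕ n} λ eq → <⇒≢ (0<fromℕ n) (sym eq)

  -- Scaling by the common denominator `d` reduces to integers, and multiplicativity cancels the
  -- factor again. A free bound `r` takes the place of a maximum.
  ∣∣ₚ-ultrametric : ∀ {r} x y → ∣ x ∣ₚ ≤ r → ∣ y ∣ₚ ≤ r → ∣ x + y ∣ₚ ≤ r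
  ∣∣ₚ-ultrametric {r} x y ∣x∣≤r ∣y∣≤r = *-cancelʳ-≤ (∣n∣ₚ>0 d)
    (subst (_≤ r * ∣ fromℕ d ∣ₚ) ∣w+z∣≡ (bound (≤-total ∣ w / 1 ∣ₚ ∣ z / 1 ∣ₚ)))
    where
    open ≡-Reasoning
    d : ℕ
    d = ↧ₙ x ℕ.* ↧ₙ y
    w z : ℤ
    w = ↥ x ℤ.* ↧ y
    z = ↥ y ℤ.* ↧ x
    w≡xd : w / 1 ≡ x * fromℕ d
    w≡xd = begin
      (↥ x ℤ.* ↧ y) / 1                          ≡⟨ /1-homo-* (↥ x) (↧ y) ⟩
      (↥ x) / 1 * fromℕ (↧ₙ y)                   ≡⟨ cong (_* fromℕ (↧ₙ y)) (x*↧x≡↥x x) ⟨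
      x * fromℕ (↧ₙ x) * fromℕ (↧ₙ y)            ≡⟨ *-assoc x (fromℕ (↧ₙ x)) (fromℕ (↧ₙ y)) ⟩
      x * (fromℕ (↧ₙ x) * fromℕ (↧ₙ y))          ≡⟨ cong (x *_) (fromℕ-homo-* (↧ₙ x) (↧ₙ y)) ⟨
      x * fromℕ d                                ∎
    z≡yd : z / 1 ≡ y * fromℕ d
    z≡yd = begin
      (↥ y ℤ.* ↧ x) / 1                          ≡⟨ /1-homo-* (↥ y) (↧ x) ⟩
      (↥ y) / 1 * fromℕ (↧ₙ x)                   ≡⟨ cong (_* fromℕ (↧ₙ x)) (x*↧x≡↥x y) ⟨
      y * fromℕ (↧ₙ y) * fromℕ (↧ₙ x)            ≡⟨ lemma y (fromℕ (↧ₙ y)) (fromℕ (↧ₙ x)) ⟩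
      y * (fromℕ (↧ₙ x) * fromℕ (↧ₙ y))          ≡⟨ cong (y *_) (fromℕ-homo-* (↧ₙ x) (↧ₙ y)) ⟨
      y * fromℕ d                                ∎
      where
      lemma : ∀ x y z → x * y * z ≡ x * (z * y)
      lemma = solve-∀ ℚ-ring
    ∣w∣≤ : ∣ w / 1 ∣ₚ ≤ r * ∣ fromℕ d ∣ₚ
    ∣w∣≤ = subst (_≤ r * ∣ fromℕ d ∣ₚ) (sym (trans (cong ∣_∣ₚ w≡xd) (∣∣ₚ-homo-* x (fromℕ d)))) (*-monoʳ-≤ (∣∣ₚ≥0 (fromℕ d)) ∣x∣≤r)
    ∣z∣≤ : ∣ z / 1 ∣ₚ ≤ r * ∣ fromℕ d ∣ₚ
    ∣z∣≤ = subst (_≤ r * ∣ fromℕ d ∣ₚ) (sym (trans (cong ∣_∣ₚ z≡yd) (∣∣ₚ-homo-* y (fromℕ d)))) (*-monoʳ-≤ (∣∣ₚ≥0 (fromℕ d)) ∣y∣≤r)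
    ∣w+z∣≡ : ∣ (w ℤ.+ z) / 1 ∣ₚ ≡ ∣ x + y ∣ₚ * ∣ fromℕ d ∣ₚ
    ∣w+z∣≡ = begin
      ∣ (w ℤ.+ z) / 1 ∣ₚ             ≡⟨ cong ∣_∣ₚ (trans (/1-homo-+ w z) (cong₂ _+_ w≡xd z≡yd)) ⟩
      ∣ x * fromℕ d + y * fromℕ d ∣ₚ ≡⟨ cong ∣_∣ₚ (*-distribʳ-+ (fromℕ d) x y) ⟨
      ∣ (x + y) * fromℕ d ∣ₚ         ≡⟨ ∣∣ₚ-homo-* (x + y) (fromℕ d) ⟩
      ∣ x + y ∣ₚ * ∣ fromℕ d ∣ₚ      ∎
    bound : ∣ w / 1 ∣ₚ ≤ ∣ z / 1 ∣ₚ ⊎ ∣ z / 1 ∣ₚ ≤ ∣ w / 1 ∣ₚ → ∣ (w ℤ.+ z) / 1 ∣ₚ ≤ r * ∣ fromℕ d ∣ₚ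
    bound (inj₁ w≤z) = ≤-trans (∣∣ₚ-ultrametric-ℤ w z w≤z) ∣z∣≤
    bound (inj₂ z≤w) = ≤-trans (subst (λ x → ∣ x / 1 ∣ₚ ≤ ∣ w / 1 ∣ₚ) (ℤ.+-comm z w) (∣∣ₚ-ultrametric-ℤ z w z≤w)) ∣w∣≤

  ∣∣ₚ-isAbsoluteValue : IsAbsoluteValue ∣_∣ₚ
  ∣∣ₚ-isAbsoluteValue = record
    { abs≥0    = ∣∣ₚ≥0
    ; definite = ∣x∣ₚ≡0⇒x≡0
    ; f0≡0     = refl
    ; f1≡1     = trans (sym (*-identityʳ ∣ 1ℚ ∣ₚ)) (trans (cong (λ k → ∣ 1ℚ ∣ₚ * fromℕ (p ℕ.^ k)) (sym ν1≡0)) (∣z∣ₚ*p^ν≡1 1ℤ))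
    ; homo-*   = ∣∣ₚ-homo-*
    ; homo-neg = ∣-x∣ₚ≡∣x∣ₚ
    ; triangle = λ x y → ∣∣ₚ-ultrametric x y
        (0≤⇒p≤p+q (∣∣ₚ≥0 y)) (subst (∣ y ∣ₚ ≤_) (+-comm ∣ y ∣ₚ ∣ x ∣ₚ) (0≤⇒p≤p+q (∣∣ₚ≥0 x)))
    }

  open IsAbsoluteValue ∣∣ₚ-isAbsoluteValue using (f1≡1; homo-^)

  -- Recover `x` as (x + y) - y: if x + y were as small as `y`, the ultrametric inequality would
  -- make `x` as small too.
  ∣∣ₚ-isosceles : ∀ x y → ∣ y ∣ₚ < ∣ x ∣ₚ → ∣ x + y ∣ₚ ≡ ∣ x ∣ₚ
  ∣∣ₚ-isosceles x y ∣y∣<∣x∣ = ≤-antisym (∣∣ₚ-ultrametric x y ≤-refl (<⇒≤ ∣y∣<∣x∣)) (bound (≤-total ∣ x + y ∣ₚ ∣ y ∣ₚ))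
    where
    ∣x∣≤ : ∀ {r} → ∣ x + y ∣ₚ ≤ r → ∣ y ∣ₚ ≤ r → ∣ x ∣ₚ ≤ r
    ∣x∣≤ {r} ∣x+y∣≤r ∣y∣≤r = subst (λ z → ∣ z ∣ₚ ≤ r) (lemma x y)
      (∣∣ₚ-ultrametric (x + y) (- y) ∣x+y∣≤r (subst (_≤ r) (sym (∣-x∣ₚ≡∣x∣ₚ y)) ∣y∣≤r))
      where
      lemma : ∀ x y → x + y + - y ≡ x
      lemma = solve-∀ ℚ-ring
    bound : ∣ x + y ∣ₚ ≤ ∣ y ∣ₚ ⊎ ∣ y ∣ₚ ≤ ∣ x + y ∣ₚ → ∣ x ∣ₚ ≤ ∣ x + y ∣ₚ
    bound (inj₁ x+y≤y) = contradiction (<-≤-trans ∣y∣<∣x∣ (∣x∣≤ x+y≤y ≤-refl)) (<-irrefl refl)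
    bound (inj₂ y≤x+y) = ∣x∣≤ ≤-refl y≤x+y

  -- Divisibility by p and p-integral rationals.

  p∤z⇒∣z∣ₚ≡1 : ∀ z → ¬ p ℕ.∣ ℤ.∣ z ∣ → ∣ z / 1 ∣ₚ ≡ 1ℚ
  p∤z⇒∣z∣ₚ≡1 z p∤z = trans (sym (*-identityʳ ∣ z / 1 ∣ₚ))
    (trans (cong (λ k → ∣ z / 1 ∣ₚ * fromℕ (p ℕ.^ k)) (sym ν≡0)) (∣z∣ₚ*p^ν≡1 z))
    where
    instance _ = ℕ.≢-nonZero {ℤ.∣ z ∣} λ eq → p∤z (subst (p ℕ.∣_) (sym eq) (p ℕ.∣0))
    ν≡0 : ν ℤ.∣ z ∣ ≡ 0
    ν≡0 with ν ℤ.∣ z ∣ | p^ν∣n ℤ.∣ z ∣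
    ... | zero  | _ = refl
    ... | suc k | p^∣z = contradiction (ℕ.m*n∣⇒m∣ p (p ℕ.^ k) p^∣z) p∤z

  p∣z⇒∣z∣ₚ<1 : ∀ z → p ℕ.∣ ℤ.∣ z ∣ → ∣ z / 1 ∣ₚ < 1ℚ
  p∣z⇒∣z∣ₚ<1 z p∣z with ∣ z / 1 ∣ₚ <? 1ℚ
  ... | yes lt = lt
  ... | no  ge = contradiction (fromℕ-cancel-≤ {p} {1} (begin
    fromℕ p                          ≡⟨ cong fromℕ (ℕ.^-identityʳ p) ⟨
    fromℕ (p ℕ.^ 1)                  ≡⟨ *-identityˡ (fromℕ (p ℕ.^ 1)) ⟨
    1ℚ * fromℕ (p ℕ.^ 1)             ≤⟨ *-monoʳ-≤ (<⇒≤ (0<p^ 1)) (≮⇒≥ ge) ⟩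
    ∣ z / 1 ∣ₚ * fromℕ (p ℕ.^ 1)     ≤⟨ p^k∣z⇒∣z∣ₚ*p^k≤1 1 z (subst (ℕ._∣ ℤ.∣ z ∣) (sym (ℕ.^-identityʳ p)) p∣z) ⟩
    1ℚ                               ∎)) (ℕ.<⇒≱ 1<p)
    where open ≤-Reasoning

  ∣↥x∣ₚ≡ : ∀ x → ∣ x ∣ₚ * ∣ fromℕ (↧ₙ x) ∣ₚ ≡ ∣ (↥ x) / 1 ∣ₚ
  ∣↥x∣ₚ≡ x = trans (sym (∣∣ₚ-homo-* x (fromℕ (↧ₙ x)))) (cong ∣_∣ₚ (x*↧x≡↥x x))

  ↥-↧-coprime : ∀ x → ℕ.Coprime ℤ.∣ ↥ x ∣ (↧ₙ x)
  ↥-↧-coprime (mkℚ _ _ c) = ℕ.recompute c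

  -- If `p` divided the denominator, coprimality would keep it out of the numerator, giving the
  -- numerator size 1 although it is `x` times a denominator of size below 1.
  ∣x∣ₚ≤1⇒p∤↧x : ∀ x → ∣ x ∣ₚ ≤ 1ℚ → ¬ p ℕ.∣ ↧ₙ x
  ∣x∣ₚ≤1⇒p∤↧x x ∣x∣≤1 p∣↧x with p ℕ.∣? ℤ.∣ ↥ x ∣
  ... | yes p∣↥x = contradiction (↥-↧-coprime x (p∣↥x , p∣↧x)) (ℕ.>⇒≢ 1<p)
  ... | no  p∤↥x = <-irrefl refl (begin-strict
    1ℚ                           ≡⟨ p∤z⇒∣z∣ₚ≡1 (↥ x) p∤↥x ⟨
    ∣ (↥ x) / 1 ∣ₚ               ≡⟨ ∣↥x∣ₚ≡ x ⟨
    ∣ x ∣ₚ * ∣ fromℕ (↧ₙ x) ∣ₚ   ≤⟨ *-monoʳ-≤ (∣∣ₚ≥0 (fromℕ (↧ₙ x))) ∣x∣≤1 ⟩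
    1ℚ * ∣ fromℕ (↧ₙ x) ∣ₚ       ≡⟨ *-identityˡ ∣ fromℕ (↧ₙ x) ∣ₚ ⟩
    ∣ fromℕ (↧ₙ x) ∣ₚ            <⟨ p∣z⇒∣z∣ₚ<1 (↧ x) p∣↧x ⟩
    1ℚ                           ∎)
    where open ≤-Reasoning

  ∣x∣ₚ≤1⇒∣↧x∣ₚ≡1 : ∀ x → ∣ x ∣ₚ ≤ 1ℚ → ∣ fromℕ (↧ₙ x) ∣ₚ ≡ 1ℚ
  ∣x∣ₚ≤1⇒∣↧x∣ₚ≡1 x ∣x∣≤1 = p∤z⇒∣z∣ₚ≡1 (↧ x) (∣x∣ₚ≤1⇒p∤↧x x ∣x∣≤1)

  ∣∣ₚ-*≤1 : ∀ x y {r} → 0ℚ ≤ r → ∣ x ∣ₚ ≤ r → ∣ y ∣ₚ ≤ 1ℚ → ∣ x * y ∣ₚ ≤ r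
  ∣∣ₚ-*≤1 x y {r} 0≤r ∣x∣≤r ∣y∣≤1 = subst₂ _≤_ (sym (∣∣ₚ-homo-* x y)) (*-identityʳ r)
    (*-mono-≤ (∣∣ₚ≥0 x) (<⇒≤ 0<1) ∣x∣≤r ∣y∣≤1)

  -- Growth for the p-adic absolute value.

  ∣b-n∣ₚ≤1 : ∀ b → ∣ b ∣ₚ ≤ 1ℚ → ∀ n → ∣ b - fromℕ n ∣ₚ ≤ 1ℚ
  ∣b-n∣ₚ≤1 b ∣b∣≤1 n = ∣∣ₚ-ultrametric b (- fromℕ n) ∣b∣≤1 (subst (_≤ 1ℚ) (sym (∣-x∣ₚ≡∣x∣ₚ (fromℕ n))) (∣z∣ₚ≤1 (ℤ.+ n)))

  ∣fallingFactorial∣ₚ≤1 : ∀ b → ∣ b ∣ₚ ≤ 1ℚ → ∀ n → ∣ fallingFactorial b n ∣ₚ ≤ 1ℚ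
  ∣fallingFactorial∣ₚ≤1 b ∣b∣≤1 zero    = ≤-reflexive f1≡1
  ∣fallingFactorial∣ₚ≤1 b ∣b∣≤1 (suc n) = ∣∣ₚ-*≤1 (fallingFactorial b n) (b - fromℕ n) (<⇒≤ 0<1)
    (∣fallingFactorial∣ₚ≤1 b ∣b∣≤1 n) (∣b-n∣ₚ≤1 b ∣b∣≤1 n)

  -- Divisibility by n! is carried directly as a p-adic bound: Pascal's rule writes the next case as
  -- a sum of two terms that both satisfy it, and the ultrametric inequality preserves it.
  ∣fallingFactorial[m,n]∣ₚ≤∣n!∣ₚ : ∀ m n → ∣ fallingFactorial (fromℕ m) n ∣ₚ ≤ ∣ fromℕ (n !) ∣ₚ
  ∣fallingFactorial[m,n]∣ₚ≤∣n!∣ₚ m zero = ≤-refl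
  ∣fallingFactorial[m,n]∣ₚ≤∣n!∣ₚ zero (suc n) =
    subst (_≤ ∣ fromℕ (suc n !) ∣ₚ) (cong ∣_∣ₚ (sym (fallingFactorial-0 n))) (∣∣ₚ≥0 (fromℕ (suc n !)))
  ∣fallingFactorial[m,n]∣ₚ≤∣n!∣ₚ (suc m) (suc n) =
    subst (λ x → ∣ x ∣ₚ ≤ ∣ fromℕ (suc n !) ∣ₚ)
      (sym (trans (cong (λ x → fallingFactorial x (suc n)) (fromℕ-suc m)) (fallingFactorial-pascal (fromℕ m) n)))
      (∣∣ₚ-ultrametric (fallingFactorial (fromℕ m) (suc n)) (fromℕ (suc n) * fallingFactorial (fromℕ m) n)
        (∣fallingFactorial[m,n]∣ₚ≤∣n!∣ₚ m (suc n))
        (begin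
          ∣ fromℕ (suc n) * fallingFactorial (fromℕ m) n ∣ₚ       ≡⟨ ∣∣ₚ-homo-* (fromℕ (suc n)) (fallingFactorial (fromℕ m) n) ⟩
          ∣ fromℕ (suc n) ∣ₚ * ∣ fallingFactorial (fromℕ m) n ∣ₚ  ≤⟨ *-monoˡ-≤ (∣∣ₚ≥0 (fromℕ (suc n))) (∣fallingFactorial[m,n]∣ₚ≤∣n!∣ₚ m n) ⟩
          ∣ fromℕ (suc n) ∣ₚ * ∣ fromℕ (n !) ∣ₚ                   ≡⟨ ∣∣ₚ-homo-* (fromℕ (suc n)) (fromℕ (n !)) ⟨
          ∣ fromℕ (suc n) * fromℕ (n !) ∣ₚ                        ≡⟨ cong ∣_∣ₚ (fromℕ-homo-* (suc n) (n !)) ⟨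
          ∣ fromℕ (suc n !) ∣ₚ                                    ∎))
    where open ≤-Reasoning

  -- A polynomial with integer coefficients is 1-Lipschitz on the p-adic integers. Here the factors
  -- of one product are exchanged for those of the other one at a time.
  fallingFactorial-close : ∀ b c {r} → 0ℚ ≤ r → ∣ b ∣ₚ ≤ 1ℚ → ∣ c ∣ₚ ≤ 1ℚ → ∣ b - c ∣ₚ ≤ r →
    ∀ n → ∣ fallingFactorial b n - fallingFactorial c n ∣ₚ ≤ r
  fallingFactorial-close b c 0≤r ∣b∣≤1 ∣c∣≤1 ∣b-c∣≤r zero = 0≤r
  fallingFactorial-close b c {r} 0≤r ∣b∣≤1 ∣c∣≤1 ∣b-c∣≤r (suc n) =
    subst (λ x → ∣ x ∣ₚ ≤ r) (lemma B C b c (fromℕ n))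
      (∣∣ₚ-ultrametric ((B - C) * (b - fromℕ n)) ((b - c) * C)
        (∣∣ₚ-*≤1 (B - C) (b - fromℕ n) 0≤r (fallingFactorial-close b c 0≤r ∣b∣≤1 ∣c∣≤1 ∣b-c∣≤r n) (∣b-n∣ₚ≤1 b ∣b∣≤1 n))
        (∣∣ₚ-*≤1 (b - c) C 0≤r ∣b-c∣≤r (∣fallingFactorial∣ₚ≤1 c ∣c∣≤1 n)))
    where
    B C : ℚ
    B = fallingFactorial b n
    C = fallingFactorial c n
    lemma : ∀ B C b c m → (B - C) * (b - m) + (b - c) * C ≡ B * (b - m) - C * (c - m)
    lemma = solve-∀ ℚ-ring

  ∣p∣ₚ : ℚ
  ∣p∣ₚ = ∣ fromℕ p ∣ₚ

  ∣p∣ₚ<1 : ∣p∣ₚ < 1ℚ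
  ∣p∣ₚ<1 = p∣z⇒∣z∣ₚ<1 (ℤ.+ p) ℕ.∣-refl

  ∣p^k∣ₚ≡∣p∣ₚ^k : ∀ k → ∣ fromℕ (p ℕ.^ k) ∣ₚ ≡ ∣p∣ₚ ^ k
  ∣p^k∣ₚ≡∣p∣ₚ^k k = trans (cong ∣_∣ₚ (fromℕ-^ k)) (homo-^ (fromℕ p) k)
    where
    fromℕ-^ : ∀ k → fromℕ (p ℕ.^ k) ≡ fromℕ p ^ k
    fromℕ-^ zero    = refl
    fromℕ-^ (suc k) = trans (fromℕ-homo-* p (p ℕ.^ k)) (cong (fromℕ p *_) (fromℕ-^ k))

  ∣p^k∣ₚ-eventually-< : ∀ {δ} → 0ℚ < δ → ∃[ K ] ∀ k → K ℕ.≤ k → ∣ fromℕ (p ℕ.^ k) ∣ₚ < δ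
  ∣p^k∣ₚ-eventually-< {δ} 0<δ = let K , small = ^-eventually-< (∣n∣ₚ>0 p) ∣p∣ₚ<1 0<δ in
    K , λ k K≤k → subst (_< δ) (sym (∣p^k∣ₚ≡∣p∣ₚ^k k)) (small k K≤k)

  -- Otherwise `p ^ k` would divide the smaller positive number `n`.
  ∣p^k∣ₚ<∣n∣ₚ : ∀ k n .{{_ : ℕ.NonZero n}} → n ℕ.< p ℕ.^ k → ∣ fromℕ (p ℕ.^ k) ∣ₚ < ∣ fromℕ n ∣ₚ
  ∣p^k∣ₚ<∣n∣ₚ k n n<p^k with ∣ fromℕ (p ℕ.^ k) ∣ₚ <? ∣ fromℕ n ∣ₚ
  ... | yes lt = lt
  ... | no  ge = contradiction (ℕ.∣⇒≤ (∣z∣ₚ*p^k≤1⇒p^k∣z k (ℤ.+ n)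
    (≤-trans (*-monoʳ-≤ (<⇒≤ (0<p^ k)) (≮⇒≥ ge)) (p^k∣z⇒∣z∣ₚ*p^k≤1 k (ℤ.+ (p ℕ.^ k)) ℕ.∣-refl)))) (ℕ.<⇒≱ n<p^k)

  p∤n⇒coprime : ∀ {n} → ¬ p ℕ.∣ n → ℕ.Coprime n p
  p∤n⇒coprime p∤n (d∣n , d∣p) with prime⇒irreducible p-prime d∣p
  ... | inj₁ d≡1 = d≡1
  ... | inj₂ refl = contradiction d∣n p∤n

  coprime⇒invertible : ∀ {s m} → ℕ.Coprime s m → ∃[ t ] ∃[ q ] ℤ.+ s ℤ.* t ≡ 1ℤ ℤ.+ q ℤ.* ℤ.+ m
  coprime⇒invertible {s} {m} c with ℕ.coprime-Bézout c
  ... | ℕ.Bézout.+- x y eq = ℤ.+ x , ℤ.+ y , (begin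
    ℤ.+ s ℤ.* ℤ.+ x          ≡⟨ ℤ.*-comm (ℤ.+ s) (ℤ.+ x) ⟩
    ℤ.+ x ℤ.* ℤ.+ s          ≡⟨ ℤ.pos-* x s ⟨
    ℤ.+ (x ℕ.* s)            ≡⟨ cong ℤ.+_ eq ⟨
    1ℤ ℤ.+ ℤ.+ (y ℕ.* m)     ≡⟨ cong ℤ.suc (ℤ.pos-* y m) ⟩
    1ℤ ℤ.+ ℤ.+ y ℤ.* ℤ.+ m   ∎)
    where open ≡-Reasoning
  ... | ℕ.Bézout.-+ x y eq = ℤ.- ℤ.+ x , ℤ.- ℤ.+ y , lemma (ℤ.+ s) (ℤ.+ x) (ℤ.+ y) (ℤ.+ m)
    (trans (cong ℤ.suc (sym (ℤ.pos-* x s))) (trans (cong ℤ.+_ eq) (ℤ.pos-* y m)))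
    where
    lemma : ∀ s x y m → 1ℤ ℤ.+ x ℤ.* s ≡ y ℤ.* m → s ℤ.* (ℤ.- x) ≡ 1ℤ ℤ.+ (ℤ.- y) ℤ.* m
    lemma s x y m eq = trans (identity s x y m) (trans (cong (λ w → 1ℤ ℤ.- w) eq) (cong ℤ.suc (ℤ.neg-distribˡ-* y m)))
      where
      identity : ∀ s x y m → s ℤ.* (ℤ.- x) ≡ 1ℤ ℤ.- (1ℤ ℤ.+ x ℤ.* s)
      identity = ℤ-solve-∀

  -- With `b` equal to r / s in lowest terms, `p` does not divide `s`, so `s` has an inverse `t`
  -- modulo `p ^ k`; `m` is the residue of `r t`.
  truncation : ∀ b → ∣ b ∣ₚ ≤ 1ℚ → ∀ k → ∃[ m ] m ℕ.< p ℕ.^ k × ∣ b - fromℕ m ∣ₚ ≤ ∣ fromℕ (p ℕ.^ k) ∣ₚ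
  truncation b ∣b∣≤1 k = m , ℤ.n%ℕd<d (r ℤ.* t) P , close
    where
    P s : ℕ
    P = p ℕ.^ k
    s = ↧ₙ b
    r : ℤ
    r = ↥ b
    instance _ = ℕ.m^n≢0 p k
    inverse : ∃[ t ] ∃[ q ] ℤ.+ s ℤ.* t ≡ 1ℤ ℤ.+ q ℤ.* ℤ.+ P
    inverse = coprime⇒invertible (coprime-^ʳ (p∤n⇒coprime (∣x∣ₚ≤1⇒p∤↧x b ∣b∣≤1)) k)
    t q w : ℤ
    t = proj₁ inverse
    q = proj₁ (proj₂ inverse)
    w = (r ℤ.* t) ℤ./ℕ P
    m : ℕ
    m = (r ℤ.* t) ℤ.%ℕ P
    s*m≡ : r ℤ.- ℤ.+ s ℤ.* ℤ.+ m ≡ (ℤ.+ s ℤ.* w ℤ.- r ℤ.* q) ℤ.* ℤ.+ P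
    s*m≡ = lemma r (ℤ.+ s) t (ℤ.+ m) q w (ℤ.+ P) (proj₂ (proj₂ inverse)) (ℤ.a≡a%ℕn+[a/ℕn]*n (r ℤ.* t) P)
      where
      lemma : ∀ r s t m q w P → s ℤ.* t ≡ 1ℤ ℤ.+ q ℤ.* P → r ℤ.* t ≡ m ℤ.+ w ℤ.* P →
        r ℤ.- s ℤ.* m ≡ (s ℤ.* w ℤ.- r ℤ.* q) ℤ.* P
      lemma r s t m q w P st≡ rt≡ = trans (identity₁ r s m q w P) (trans
        (cong₂ (λ x y → s ℤ.* w ℤ.* P ℤ.- r ℤ.* q ℤ.* P ℤ.+ (r ℤ.* x ℤ.- s ℤ.* y)) (sym st≡) (sym rt≡))
        (identity₂ r s t q w P))
        where
        identity₁ : ∀ r s m q w P → r ℤ.- s ℤ.* m ≡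
          s ℤ.* w ℤ.* P ℤ.- r ℤ.* q ℤ.* P ℤ.+ (r ℤ.* (1ℤ ℤ.+ q ℤ.* P) ℤ.- s ℤ.* (m ℤ.+ w ℤ.* P))
        identity₁ = ℤ-solve-∀
        identity₂ : ∀ r s t q w P → s ℤ.* w ℤ.* P ℤ.- r ℤ.* q ℤ.* P ℤ.+ (r ℤ.* (s ℤ.* t) ℤ.- s ℤ.* (r ℤ.* t))
          ≡ (s ℤ.* w ℤ.- r ℤ.* q) ℤ.* P
        identity₂ = ℤ-solve-∀
    z : ℤ
    z = ℤ.+ s ℤ.* w ℤ.- r ℤ.* q
    close : ∣ b - fromℕ m ∣ₚ ≤ ∣ fromℕ P ∣ₚ
    -- Multiplying by `s`, which has p-adic size 1, turns `b - m` into the integer `r - s m`, a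
    -- multiple of `p ^ k` by `s*m≡`.
    close = begin
      ∣ b - fromℕ m ∣ₚ                        ≡⟨ *-identityʳ ∣ b - fromℕ m ∣ₚ ⟨
      ∣ b - fromℕ m ∣ₚ * 1ℚ                   ≡⟨ cong (∣ b - fromℕ m ∣ₚ *_) (∣x∣ₚ≤1⇒∣↧x∣ₚ≡1 b ∣b∣≤1) ⟨
      ∣ b - fromℕ m ∣ₚ * ∣ fromℕ s ∣ₚ         ≡⟨ ∣∣ₚ-homo-* (b - fromℕ m) (fromℕ s) ⟨
      ∣ (b - fromℕ m) * fromℕ s ∣ₚ            ≡⟨ cong ∣_∣ₚ (lemma b (fromℕ m) (fromℕ s)) ⟩
      ∣ b * fromℕ s - fromℕ s * fromℕ m ∣ₚ    ≡⟨ cong₂ (λ x y → ∣ x - y ∣ₚ) (x*↧x≡↥x b) (sym (/1-homo-* (ℤ.+ s) (ℤ.+ m))) ⟩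
      ∣ r / 1 - (ℤ.+ s ℤ.* ℤ.+ m) / 1 ∣ₚ      ≡⟨ cong (λ x → ∣ r / 1 + x ∣ₚ) (/1-homo-neg (ℤ.+ s ℤ.* ℤ.+ m)) ⟨
      ∣ r / 1 + (ℤ.- (ℤ.+ s ℤ.* ℤ.+ m)) / 1 ∣ₚ ≡⟨ cong ∣_∣ₚ (/1-homo-+ r (ℤ.- (ℤ.+ s ℤ.* ℤ.+ m))) ⟨
      ∣ (r ℤ.- ℤ.+ s ℤ.* ℤ.+ m) / 1 ∣ₚ        ≡⟨ cong (λ x → ∣ x / 1 ∣ₚ) s*m≡ ⟩
      ∣ (z ℤ.* ℤ.+ P) / 1 ∣ₚ                  ≡⟨ cong ∣_∣ₚ (trans (/1-homo-* z (ℤ.+ P)) (*-comm (z / 1) (fromℕ P))) ⟩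
      ∣ fromℕ P * (z / 1) ∣ₚ                  ≤⟨ ∣∣ₚ-*≤1 (fromℕ P) (z / 1) (∣∣ₚ≥0 (fromℕ P)) ≤-refl (∣z∣ₚ≤1 z) ⟩
      ∣ fromℕ P ∣ₚ                            ∎
      where
      open ≤-Reasoning
      lemma : ∀ b m s → (b - m) * s ≡ b * s - s * m
      lemma = solve-∀ ℚ-ring

  ∣fallingFactorial∣ₚ≤∣n!∣ₚ : ∀ b → ∣ b ∣ₚ ≤ 1ℚ → ∀ n → ∣ fallingFactorial b n ∣ₚ ≤ ∣ fromℕ (n !) ∣ₚ
  ∣fallingFactorial∣ₚ≤∣n!∣ₚ b ∣b∣≤1 n = subst (λ x → ∣ x ∣ₚ ≤ ∣ fromℕ (n !) ∣ₚ) (p+[q-p]≡q M B)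
    (∣∣ₚ-ultrametric M (B - M) (∣fallingFactorial[m,n]∣ₚ≤∣n!∣ₚ m n)
      (≤-trans (fallingFactorial-close b (fromℕ m) (∣∣ₚ≥0 (fromℕ (p ℕ.^ K))) ∣b∣≤1 (∣z∣ₚ≤1 (ℤ.+ m))
        (proj₂ (proj₂ (truncation b ∣b∣≤1 K))) n)
        (<⇒≤ (proj₂ small K ℕ.≤-refl))))
    where
    -- The precision `K` depends on `n`: replacing `b` by its truncation must cost no more than the
    -- size of n!.
    small : ∃[ K ] ∀ k → K ℕ.≤ k → ∣ fromℕ (p ℕ.^ k) ∣ₚ < ∣ fromℕ (n !) ∣ₚ
    small = ∣p^k∣ₚ-eventually-< (∣n∣ₚ>0 (n !) {{n ℕ.!≢0}})
    K m : ℕ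
    K = proj₁ small
    m = proj₁ (truncation b ∣b∣≤1 K)
    B M : ℚ
    B = fallingFactorial b n
    M = fallingFactorial (fromℕ m) n

  ∣binomialCoeff∣ₚ*∣n!∣ₚ : ∀ b n → ∣ binomialCoeff b n ∣ₚ * ∣ fromℕ (n !) ∣ₚ ≡ ∣ fallingFactorial b n ∣ₚ
  ∣binomialCoeff∣ₚ*∣n!∣ₚ b n = trans (sym (∣∣ₚ-homo-* (binomialCoeff b n) (fromℕ (n !)))) (cong ∣_∣ₚ (binomialCoeff*n! b n))

  ∣binomialCoeff∣ₚ≤1 : ∀ b → ∣ b ∣ₚ ≤ 1ℚ → ∀ n → ∣ binomialCoeff b n ∣ₚ ≤ 1ℚ
  ∣binomialCoeff∣ₚ≤1 b ∣b∣≤1 n = *-cancelʳ-≤ (∣n∣ₚ>0 (n !) {{n ℕ.!≢0}})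
    (subst₂ _≤_ (sym (∣binomialCoeff∣ₚ*∣n!∣ₚ b n)) (sym (*-identityˡ ∣ fromℕ (n !) ∣ₚ)) (∣fallingFactorial∣ₚ≤∣n!∣ₚ b ∣b∣≤1 n))

  -- In (n + y)(n - 1 + y)⋯(1 + y) the perturbation y is p-adically smaller than every factor.
  ∣fallingFactorial[n+y,n]∣ₚ≡∣n!∣ₚ : ∀ k y → ∣ y ∣ₚ ≤ ∣ fromℕ (p ℕ.^ k) ∣ₚ → ∀ n → n ℕ.< p ℕ.^ k →
    ∣ fallingFactorial (fromℕ n + y) n ∣ₚ ≡ ∣ fromℕ (n !) ∣ₚ
  ∣fallingFactorial[n+y,n]∣ₚ≡∣n!∣ₚ k y ∣y∣≤ zero    _ = refl
  ∣fallingFactorial[n+y,n]∣ₚ≡∣n!∣ₚ k y ∣y∣≤ (suc n) 1+n<p^k = begin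
    ∣ fallingFactorial (fromℕ (suc n) + y) (suc n) ∣ₚ               ≡⟨ cong (λ x → ∣ fallingFactorial x (suc n) ∣ₚ) 1+n+y ⟩
    ∣ fallingFactorial (1ℚ + (fromℕ n + y)) (suc n) ∣ₚ              ≡⟨ cong ∣_∣ₚ (fallingFactorial-shift (fromℕ n + y) n) ⟩
    ∣ (1ℚ + (fromℕ n + y)) * fallingFactorial (fromℕ n + y) n ∣ₚ    ≡⟨ ∣∣ₚ-homo-* (1ℚ + (fromℕ n + y)) (fallingFactorial (fromℕ n + y) n) ⟩
    ∣ 1ℚ + (fromℕ n + y) ∣ₚ * ∣ fallingFactorial (fromℕ n + y) n ∣ₚ ≡⟨ cong₂ (λ x z → ∣ x ∣ₚ * z) (sym 1+n+y)
                                                                         (∣fallingFactorial[n+y,n]∣ₚ≡∣n!∣ₚ k y ∣y∣≤ n (ℕ.<-trans (ℕ.n<1+n n) 1+n<p^k)) ⟩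
    ∣ fromℕ (suc n) + y ∣ₚ * ∣ fromℕ (n !) ∣ₚ                       ≡⟨ cong (_* ∣ fromℕ (n !) ∣ₚ)
                                                                         (∣∣ₚ-isosceles (fromℕ (suc n)) y (≤-<-trans ∣y∣≤ (∣p^k∣ₚ<∣n∣ₚ k (suc n) 1+n<p^k))) ⟩
    ∣ fromℕ (suc n) ∣ₚ * ∣ fromℕ (n !) ∣ₚ                           ≡⟨ ∣∣ₚ-homo-* (fromℕ (suc n)) (fromℕ (n !)) ⟨
    ∣ fromℕ (suc n) * fromℕ (n !) ∣ₚ                                ≡⟨ cong ∣_∣ₚ (fromℕ-homo-* (suc n) (n !)) ⟨
    ∣ fromℕ (suc n !) ∣ₚ                                            ∎
    where
    open ≡-Reasoning
    1+n+y : fromℕ (suc n) + y ≡ 1ℚ + (fromℕ n + y)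
    1+n+y = trans (cong (_+ y) (fromℕ-suc n)) (+-assoc 1ℚ (fromℕ n) y)

  truncation-∣binomialCoeff∣ₚ≡1 : ∀ b n k → n ℕ.< p ℕ.^ k → ∣ b - fromℕ n ∣ₚ ≤ ∣ fromℕ (p ℕ.^ k) ∣ₚ →
    ∣ binomialCoeff b n ∣ₚ ≡ 1ℚ
  truncation-∣binomialCoeff∣ₚ≡1 b n k n<p^k ∣b-n∣≤ = *-cancelʳ-≡ (∣n∣ₚ>0 (n !) {{n ℕ.!≢0}}) (begin
    ∣ binomialCoeff b n ∣ₚ * ∣ fromℕ (n !) ∣ₚ          ≡⟨ ∣binomialCoeff∣ₚ*∣n!∣ₚ b n ⟩
    ∣ fallingFactorial b n ∣ₚ                          ≡⟨ cong (λ x → ∣ fallingFactorial x n ∣ₚ) (p+[q-p]≡q (fromℕ n) b) ⟨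
    ∣ fallingFactorial (fromℕ n + (b - fromℕ n)) n ∣ₚ  ≡⟨ ∣fallingFactorial[n+y,n]∣ₚ≡∣n!∣ₚ k (b - fromℕ n) ∣b-n∣≤ n n<p^k ⟩
    ∣ fromℕ (n !) ∣ₚ                                   ≡⟨ *-identityˡ ∣ fromℕ (n !) ∣ₚ ⟨
    1ℚ * ∣ fromℕ (n !) ∣ₚ                              ∎)
    where open ≡-Reasoning

  -- A non-integer `b` has positive p-adic distance to each of the finitely many `n ≤ N`, so one `K`
  -- serves them all. A truncation modulo `p ^ K`, being within that precision of `b`, must then
  -- exceed `N`.
  p^k-separates : ∀ {b} → ¬ IsInteger b → ∀ N →
    ∃[ K ] ∀ k → K ℕ.≤ k → ∀ n → n ℕ.≤ N → ∣ fromℕ (p ℕ.^ k) ∣ₚ < ∣ b - fromℕ n ∣ₚ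
  p^k-separates b∉ℤ zero = let K , small = ∣p^k∣ₚ-eventually-< (0<∣x∣ₚ (b-n≢0 b∉ℤ 0)) in
    K , λ { k K≤k zero ℕ.z≤n → small k K≤k }
  p^k-separates {b} b∉ℤ (suc N) =
    let K , separates = p^k-separates b∉ℤ N
        L , small = ∣p^k∣ₚ-eventually-< (0<∣x∣ₚ (b-n≢0 b∉ℤ (suc N)))
    in K ℕ.⊔ L , λ k K⊔L≤k n n≤1+N → [ (λ n<1+N → separates k (ℕ.m⊔n≤o⇒m≤o K L K⊔L≤k) n (ℕ.≤-pred n<1+N))
                                    , (λ { refl → small k (ℕ.m⊔n≤o⇒n≤o K L K⊔L≤k) }) ]′ (ℕ.m≤n⇒m<n∨m≡n n≤1+N)

  ∣binomialCoeff∣ₚ≡1-frequently : ∀ b → ∣ b ∣ₚ ≤ 1ℚ → ¬ IsInteger b → ∀ N →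
    ∃[ n ] N ℕ.< n × ∣ binomialCoeff b n ∣ₚ ≡ 1ℚ
  ∣binomialCoeff∣ₚ≡1-frequently b ∣b∣≤1 b∉ℤ N =
    let K , separates = p^k-separates b∉ℤ N
        n , n<p^K , close = truncation b ∣b∣≤1 K
    in n , ℕ.≰⇒> (λ n≤N → <-irrefl refl (<-≤-trans (separates K ℕ.≤-refl n n≤N) close))
         , truncation-∣binomialCoeff∣ₚ≡1 b n K n<p^K close

  ∣binomialCoeff∣ₚ-eventuallyBelowPowers : ∀ b → ∣ b ∣ₚ ≤ 1ℚ → EventuallyBelowPowers ∣_∣ₚ (binomialCoeff b)
  ∣binomialCoeff∣ₚ-eventuallyBelowPowers b ∣b∣≤1 c 1<c =
    -- The index 0 is excluded because there both sides equal 1.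
    0 , λ n 0<n → ≤-<-trans (∣binomialCoeff∣ₚ≤1 b ∣b∣≤1 n) (1<^ 1<c 0<n)

  ∣binomialCoeff∣ₚ-frequentlyAbovePowers : ∀ b → ∣ b ∣ₚ ≤ 1ℚ → ¬ IsInteger b → FrequentlyAbovePowers ∣_∣ₚ (binomialCoeff b)
  ∣binomialCoeff∣ₚ-frequentlyAbovePowers b ∣b∣≤1 b∉ℤ c 0<c c<1 N =
    let n , N<n , ∣a∣≡1 = ∣binomialCoeff∣ₚ≡1-frequently b ∣b∣≤1 b∉ℤ N in
    n , N<n , <-≤-trans (^<1 (<⇒≤ 0<c) c<1 (ℕ.≤-<-trans ℕ.z≤n N<n)) (≤-reflexive (sym ∣a∣≡1))

  -- The intersection of the two discs as a set of reduced fractions.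

  openDiscs⊆reducedFractions : ∀ x → ∣ x ∣ < 1ℚ → ∣ x ∣ₚ < 1ℚ → ReducedFractions p x
  openDiscs⊆reducedFractions x ∣x∣<1 ∣x∣ₚ<1 =
    ↥ x , ↧ x , _ , sym (↥p/↧p≡p x) , cong ℤ.+_ (ℕ.coprime⇒gcd≡1 (↥-↧-coprime x)) , ∣↥x∣≤↧x , p∣↥x , p∤↧x
    where
    p∤↧x : ¬ p ℕ.∣ ↧ₙ x
    p∤↧x = ∣x∣ₚ≤1⇒p∤↧x x (<⇒≤ ∣x∣ₚ<1)
    p∣↥x : p ℕ.∣ ℤ.∣ ↥ x ∣
    p∣↥x with p ℕ.∣? ℤ.∣ ↥ x ∣
    ... | yes p∣n = p∣n
    -- With `p` in neither numerator nor denominator, `x` would have p-adic size exactly 1.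
    ... | no  p∤n = contradiction ∣x∣ₚ<1 (<-irrefl (begin
      ∣ x ∣ₚ                       ≡⟨ *-identityʳ ∣ x ∣ₚ ⟨
      ∣ x ∣ₚ * 1ℚ                  ≡⟨ cong (∣ x ∣ₚ *_) (∣x∣ₚ≤1⇒∣↧x∣ₚ≡1 x (<⇒≤ ∣x∣ₚ<1)) ⟨
      ∣ x ∣ₚ * ∣ fromℕ (↧ₙ x) ∣ₚ   ≡⟨ ∣↥x∣ₚ≡ x ⟩
      ∣ (↥ x) / 1 ∣ₚ               ≡⟨ p∤z⇒∣z∣ₚ≡1 (↥ x) p∤n ⟩
      1ℚ                           ∎))
      where open ≡-Reasoning
    ∣↥x∣≤↧x : ℤ.∣ ↥ x ∣ ℕ.≤ ↧ₙ x
    ∣↥x∣≤↧x = fromℕ-cancel-≤ {ℤ.∣ ↥ x ∣} {↧ₙ x} (begin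
      fromℕ ℤ.∣ ↥ x ∣              ≡⟨ ∣z/1∣≡ (↥ x) ⟨
      ∣ (↥ x) / 1 ∣                ≡⟨ cong ∣_∣ (x*↧x≡↥x x) ⟨
      ∣ x * fromℕ (↧ₙ x) ∣         ≡⟨ ∣p*q∣≡∣p∣*∣q∣ x (fromℕ (↧ₙ x)) ⟩
      ∣ x ∣ * ∣ fromℕ (↧ₙ x) ∣     ≤⟨ *-monoʳ-≤ (0≤∣p∣ (fromℕ (↧ₙ x))) (<⇒≤ ∣x∣<1) ⟩
      1ℚ * ∣ fromℕ (↧ₙ x) ∣        ≡⟨ *-identityˡ ∣ fromℕ (↧ₙ x) ∣ ⟩
      ∣ fromℕ (↧ₙ x) ∣             ≡⟨ ∣z/1∣≡ (↧ x) ⟩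
      fromℕ (↧ₙ x)                 ∎)
      where open ≤-Reasoning

  reducedFractions⊆openDiscs : ∀ x → ReducedFractions p x → ∣ x ∣ < 1ℚ × ∣ x ∣ₚ < 1ℚ
  reducedFractions⊆openDiscs x (u , v , v≢0 , refl , _ , ∣u∣≤∣v∣ , p∣u , p∤v) = ∣x∣<1 , ∣x∣ₚ<1
    where
    instance _ = v≢0
    ∣u∣<∣v∣ : ℤ.∣ u ∣ ℕ.< ℤ.∣ v ∣
    -- Equality is impossible because `p` divides `u` but not `v`; so the weak inequality still
    -- lands in the open disc.
    ∣u∣<∣v∣ = ℕ.≤∧≢⇒< ∣u∣≤∣v∣ λ eq → p∤v (subst (p ℕ.∣_) eq p∣u)
    ∣x∣<1 : ∣ x ∣ < 1ℚ
    ∣x∣<1 with ∣ x ∣ <? 1ℚ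
    ... | yes lt = lt
    ... | no  ge = contradiction (fromℕ-cancel-≤ {ℤ.∣ v ∣} {ℤ.∣ u ∣} (begin
      fromℕ ℤ.∣ v ∣         ≡⟨ trans (*-identityˡ ∣ v / 1 ∣) (∣z/1∣≡ v) ⟨
      1ℚ * ∣ v / 1 ∣        ≤⟨ *-monoʳ-≤ (0≤∣p∣ (v / 1)) (≮⇒≥ ge) ⟩
      ∣ x ∣ * ∣ v / 1 ∣     ≡⟨ ∣p*q∣≡∣p∣*∣q∣ x (v / 1) ⟨
      ∣ x * (v / 1) ∣       ≡⟨ cong ∣_∣ ([u/v]*v≡u u v) ⟩
      ∣ u / 1 ∣             ≡⟨ ∣z/1∣≡ u ⟩
      fromℕ ℤ.∣ u ∣         ∎)) (ℕ.<⇒≱ ∣u∣<∣v∣)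
      where open ≤-Reasoning
    ∣x∣ₚ<1 : ∣ x ∣ₚ < 1ℚ
    ∣x∣ₚ<1 = subst (_< 1ℚ) (begin
      ∣ u / 1 ∣ₚ            ≡⟨ cong ∣_∣ₚ ([u/v]*v≡u u v) ⟨
      ∣ x * (v / 1) ∣ₚ      ≡⟨ ∣∣ₚ-homo-* x (v / 1) ⟩
      ∣ x ∣ₚ * ∣ v / 1 ∣ₚ   ≡⟨ cong (∣ x ∣ₚ *_) (p∤z⇒∣z∣ₚ≡1 v p∤v) ⟩
      ∣ x ∣ₚ * 1ℚ           ≡⟨ *-identityʳ ∣ x ∣ₚ ⟩
      ∣ x ∣ₚ                ∎) (p∣z⇒∣z∣ₚ<1 u p∣u)
      where open ≡-Reasoning

theorem4p3 :
    (p : ℕ) (p-prime : Prime p) (b : ℚ) → IsPadicInteger p-prime b → ¬ IsInteger b →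
    (HasRadiusOfConvergence ∣_∣ (binomialCoeff b) 1ℚ
      × HasRadiusOfConvergence (padicAbs p-prime) (binomialCoeff b) 1ℚ)
    × (OpenDisc ∣_∣ 1ℚ ∩ OpenDisc (padicAbs p-prime) 1ℚ ≐ ReducedFractions p)
    × (OpenDisc ∣_∣ 1ℚ ∩ OpenDisc (padicAbs p-prime) 1ℚ
        ⊆ ConvergenceSet ∣_∣ (binomialCoeff b) ∩ ConvergenceSet (padicAbs p-prime) (binomialCoeff b))
theorem4p3 p p-prime b ∣b∣ₚ≤1 b∉ℤ =
    ( radius≡1 ∣_∣ (binomialCoeff b) (∣binomialCoeff∣-eventuallyBelowPowers b) (∣binomialCoeff∣-frequentlyAbovePowers b b∉ℤ)
    , radius≡1 (padicAbs p-prime) (binomialCoeff b)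
        (∣binomialCoeff∣ₚ-eventuallyBelowPowers p-prime b ∣b∣ₚ≤1)
        (∣binomialCoeff∣ₚ-frequentlyAbovePowers p-prime b ∣b∣ₚ≤1 b∉ℤ))
  , ( (λ {x} (∣x∣<1 , ∣x∣ₚ<1) → openDiscs⊆reducedFractions p-prime x ∣x∣<1 ∣x∣ₚ<1)
    , λ {x} → reducedFractions⊆openDiscs p-prime x)
  , λ {x} (∣x∣<1 , ∣x∣ₚ<1) →
      openDisc⊆convergenceSet ∣∣-isAbsoluteValue (∣binomialCoeff∣-eventuallyBelowPowers b) ∣x∣<1
    , openDisc⊆convergenceSet (∣∣ₚ-isAbsoluteValue p-prime) (∣binomialCoeff∣ₚ-eventuallyBelowPowers p-prime b ∣b∣ₚ≤1) ∣x∣ₚ<1
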